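{- Let $r\colon\mathbb{N}\to\mathbb{N}$ be a function with $r(n)=o(\sqrt{n})$. Then there is a function $\epsilon\colon\mathbb{N}\to[0,\infty)$ with $\epsilon(n)\to 0$ as $n\to\infty$ such that for all $n\in\mathbb{N}$, all $m\in\mathbb{N}$ and all $\xi\in(0,1)$, the complete complex $\mathcal{C}_n$ on vertex set $[n]$ is an $(m,r(n),\xi,\xi+\epsilon(n))$ UG coboundary expander.
   Context: The complete complex $\mathcal{C}=\mathcal{C}_n$ has vertex set $[n]=\{1,\dots,n\}$, and its $i$-th level $\mathcal{C}(i)$ consists of all $i$-element subsets of $[n]$; $\mu_i$ is the uniform measure on $\mathcal{C}(i)$. For $t\le n/3$, $E_t$ is the set of ordered pairs $(u,v)$ of disjoint $t$-element subsets of $[n]$. A function $\pi\colon E_t\to S_m$ with $\pi(u,v)=\pi(v,u)^{ -1}$ is $(1-\xi)$-consistent on triangles if, sampling a uniformly random $3t$-element set $T$ and a uniformly random splitting $T=u\cup v\cup w$ into sets of size $t$, $\Pr[\pi(u,v)\pi(v,w)=\pi(u,w)]\ge1-\xi$. The complex is an $(m,r,\xi,c)$ UG coboundary expander if for all $t\le r$ (with $t\le n/3$) and every such $\pi\colon E_t\to S_m$ that is $(1-\xi)$-consistent on triangles, there is $g\colon\mathcal{C}(t)\to S_m$ such that $\Pr[\pi(u,v)=g(u)g(v)^{ -1}]\ge1-c$, where $(u,v)$ is a uniformly random pair in $E_t$. -}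

module Defs where

open import Data.Bool.Base using (if_then_else_)
import Data.Bool.Properties as Bool
open import Data.Fin.Properties as Fin using (all?)
open import Data.Fin.Permutation
  using (Permutation′; _⟨$⟩ʳ_; _∘ₚ_; flip) renaming (_≈_ to _≈ₚ_)
open import Data.Fin.Subset using (Subset; inside; outside; Empty; _∩_; _∪_)
  renaming (∣_∣ to size)
open import Data.Fin.Subset.Properties using (nonempty?; ∩-comm)
import Data.Integer.Base as ℤ
open import Data.Integer.Base using (+_)
import Data.Integer.Properties as ℤ
import Data.Integer.Solver as ℤ-Solver
open import Data.Irrelevant as Irr using ([_])
open import Data.List.Base
  using (List; []; _∷_; _++_; map; foldr; length; cartesianProduct)
import Data.Nat.Base as ℕ
open import Data.Nat.Base using (ℕ; zero; suc; _≥_)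
import Data.Nat.Properties as ℕ
open import Data.Product.Base using (∃-syntax; _×_; _,_; proj₁; proj₂)
open import Data.Rational.Base as ℚ using (ℚ; 0ℚ; 1ℚ; _/_; ∣_∣)
import Data.Rational.Properties as ℚ
open import Data.Rational.Solver using (module +-*-Solver)
open import Data.Rational.Unnormalised.Base as ℚᵘ using (mkℚᵘ)
import Data.Rational.Unnormalised.Properties as ℚᵘ
open import Data.Refinement using (Refinement-syntax; value; _,_)
import Data.Vec.Base as Vec
import Data.Vec.Properties as Vec
open import Function.Base using (_∘_)
open import Relation.Binary.PropositionalEquality
  using (_≡_; refl; sym; cong; cong₂; subst)
open import Relation.Nullary using (Dec; yes; no; does)
open import Relation.Nullary.Decidable using (¬?; _×-dec_)
open import Relation.Unary using (Decidable)

-- Real numbers, as regular sequences of rationals (Bishop): a sequence x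
-- represents its limit, and |xᵢ - lim x| ≤ 1/(i+1).

recip : ℕ → ℚ
recip k = + 1 / suc k

record ℝ : Set where
  field
    seq     : ℕ → ℚ
    regular : ∀ i j → ∣ seq i ℚ.- seq j ∣ ℚ.≤ recip i ℚ.+ recip j

open ℝ public

-- In terms of limits: since xₖ and yₖ are each within 1/(k+1) of the limit,
-- lim x ≤ lim y iff xₖ - yₖ ≤ 2/(k+1) for all k, and lim x < lim y iff
-- yₖ - xₖ > 2/(k+1) for some k.
infix 4 _≤ᴿ_ _<ᴿ_
infixl 6 _+ᴿ_ _-ᴿ_
infix 8 -ᴿ_

_≤ᴿ_ : ℝ → ℝ → Set
x ≤ᴿ y = ∀ k → seq x k ℚ.- seq y k ℚ.≤ recip k ℚ.+ recip k

_<ᴿ_ : ℝ → ℝ → Set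
x <ᴿ y = ∃[ k ] recip k ℚ.+ recip k ℚ.< seq y k ℚ.- seq x k

private
  recip-nonNeg : ∀ k → 0ℚ ℚ.≤ recip k
  recip-nonNeg k = ℚ.nonNegative⁻¹ (recip k) {{ℚ.normalize-nonNeg 1 (suc k)}}

  recip-half : ∀ k → recip (1 ℕ.+ 2 ℕ.* k) ℚ.+ recip (1 ℕ.+ 2 ℕ.* k) ≡ recip k
  recip-half k = ℚ.toℚᵘ-injective (ℚᵘ.≃-trans
      (ℚ.toℚᵘ-homo-+ (recip d) (recip d))
      (ℚᵘ.≃-trans (ℚᵘ.+-cong (toᵘ d) (toᵘ d))
      (ℚᵘ.≃-trans (ℚᵘ.*≡* (halves (+ k) (+ d) (cong (ℤ._+_ (+ 1)) (ℤ.pos-* 2 k)))) (ℚᵘ.≃-sym (toᵘ k)))))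
    where
    d : ℕ
    d = 1 ℕ.+ 2 ℕ.* k
    toᵘ : ∀ j → ℚ.toℚᵘ (recip j) ℚᵘ.≃ mkℚᵘ (+ 1) j
    toᵘ j = ℚ.toℚᵘ-fromℚᵘ (mkℚᵘ (+ 1) j)
    halves : ∀ x y → y ≡ + 1 ℤ.+ + 2 ℤ.* x →
      (+ 1 ℤ.* (+ 1 ℤ.+ y) ℤ.+ + 1 ℤ.* (+ 1 ℤ.+ y)) ℤ.* (+ 1 ℤ.+ x)
        ≡ + 1 ℤ.* ((+ 1 ℤ.+ y) ℤ.* (+ 1 ℤ.+ y))
    halves x _ refl = identity x
      where
      identity : ∀ x →
        let z = + 1 ℤ.+ (+ 1 ℤ.+ + 2 ℤ.* x) in
        (+ 1 ℤ.* z ℤ.+ + 1 ℤ.* z) ℤ.* (+ 1 ℤ.+ x) ≡ + 1 ℤ.* (z ℤ.* z)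
      identity = solve 1 (λ x →
        let z = con (+ 1) :+ (con (+ 1) :+ con (+ 2) :* x) in
        (con (+ 1) :* z :+ con (+ 1) :* z) :* (con (+ 1) :+ x) := con (+ 1) :* (z :* z)) refl
        where open ℤ-Solver.+-*-Solver

  interchange : ∀ a b c d → (a ℚ.+ b) ℚ.+ (c ℚ.+ d) ≡ (a ℚ.+ c) ℚ.+ (b ℚ.+ d)
  interchange = solve 4 (λ a b c d → (a :+ b) :+ (c :+ d) := (a :+ c) :+ (b :+ d)) refl
    where open +-*-Solver

  interchange⁻ : ∀ a b c d → (a ℚ.+ b) ℚ.- (c ℚ.+ d) ≡ (a ℚ.- c) ℚ.+ (b ℚ.- d)
  interchange⁻ = solve 4 (λ a b c d → (a :+ b) :- (c :+ d) := (a :- c) :+ (b :- d)) refl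
    where open +-*-Solver

fromℚ : ℚ → ℝ
fromℚ q .seq _ = q
fromℚ q .regular i j = begin
  ∣ q ℚ.- q ∣         ≡⟨ cong ∣_∣ (ℚ.+-inverseʳ q) ⟩
  0ℚ                  ≤⟨ ℚ.+-mono-≤ (recip-nonNeg i) (recip-nonNeg j) ⟩
  recip i ℚ.+ recip j ∎
  where open ℚ.≤-Reasoning

-ᴿ_ : ℝ → ℝ
(-ᴿ x) .seq k = ℚ.- seq x k
(-ᴿ x) .regular i j = begin
  ∣ ℚ.- seq x i ℚ.- ℚ.- seq x j ∣ ≡⟨ cong ∣_∣ (sym (ℚ.neg-distrib-+ (seq x i) (ℚ.- seq x j))) ⟩
  ∣ ℚ.- (seq x i ℚ.- seq x j) ∣   ≡⟨ ℚ.∣-p∣≡∣p∣ (seq x i ℚ.- seq x j) ⟩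
  ∣ seq x i ℚ.- seq x j ∣         ≤⟨ regular x i j ⟩
  recip i ℚ.+ recip j             ∎
  where open ℚ.≤-Reasoning

-- The index 2k+1 makes the two errors 1/(2k+2) add up to 1/(k+1).
_+ᴿ_ : ℝ → ℝ → ℝ
(x +ᴿ y) .seq k = seq x (1 ℕ.+ 2 ℕ.* k) ℚ.+ seq y (1 ℕ.+ 2 ℕ.* k)
(x +ᴿ y) .regular i j = begin
  ∣ (seq x i′ ℚ.+ seq y i′) ℚ.- (seq x j′ ℚ.+ seq y j′) ∣
    ≡⟨ cong ∣_∣ (interchange⁻ (seq x i′) (seq y i′) (seq x j′) (seq y j′)) ⟩
  ∣ (seq x i′ ℚ.- seq x j′) ℚ.+ (seq y i′ ℚ.- seq y j′) ∣
    ≤⟨ ℚ.∣p+q∣≤∣p∣+∣q∣ (seq x i′ ℚ.- seq x j′) (seq y i′ ℚ.- seq y j′) ⟩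
  ∣ seq x i′ ℚ.- seq x j′ ∣ ℚ.+ ∣ seq y i′ ℚ.- seq y j′ ∣
    ≤⟨ ℚ.+-mono-≤ (regular x i′ j′) (regular y i′ j′) ⟩
  (recip i′ ℚ.+ recip j′) ℚ.+ (recip i′ ℚ.+ recip j′)
    ≡⟨ interchange (recip i′) (recip j′) (recip i′) (recip j′) ⟩
  (recip i′ ℚ.+ recip i′) ℚ.+ (recip j′ ℚ.+ recip j′)
    ≡⟨ cong₂ ℚ._+_ (recip-half i) (recip-half j) ⟩
  recip i ℚ.+ recip j ∎
  where
  open ℚ.≤-Reasoning
  i′ j′ : ℕ
  i′ = 1 ℕ.+ 2 ℕ.* i
  j′ = 1 ℕ.+ 2 ℕ.* j

_-ᴿ_ : ℝ → ℝ → ℝ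
x -ᴿ y = x +ᴿ (-ᴿ y)

0ᴿ 1ᴿ : ℝ
0ᴿ = fromℚ 0ℚ
1ᴿ = fromℚ 1ℚ

fromℕ : ℕ → ℚ
fromℕ k = + k / 1

TendsToZero : (ℕ → ℝ) → Set
TendsToZero ε = ∀ (δ : ℝ) → 0ᴿ <ᴿ δ →
  ∃[ N ] (∀ n → n ≥ N → (-ᴿ δ <ᴿ ε n) × (ε n <ᴿ δ))

-- r(n) = o(√n): for every c > 0, eventually r(n) ≤ c√n.  Both sides being
-- nonnegative, the inequality is written r(n)² ≤ c²n.  Rational c suffice, as
-- there is a positive rational below every positive real.
IsLittleO√ : (ℕ → ℕ) → Set
IsLittleO√ r = ∀ (c : ℚ) → 0ℚ ℚ.< c →
  ∃[ N ] (∀ n → n ≥ N → fromℕ (r n ℕ.* r n) ℚ.≤ (c ℚ.* c) ℚ.* fromℕ n)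

-- The average over a duplicate-free enumeration of a finite set.  The value
-- on the empty list is a dummy: the lists averaged over in
-- IsUGCoboundaryExpander are nonempty, because there 3t ≤ n.
𝔼 : {A : Set} → List A → (A → ℚ) → ℚ
𝔼 []          f = 0ℚ
𝔼 xs@(_ ∷ ys) f = foldr ℚ._+_ 0ℚ (map f xs) ℚ.* recip (length ys)

Pr : {A : Set} {P : A → Set} → List A → Decidable P → ℚ
Pr xs P? = 𝔼 xs (λ x → if does (P? x) then 1ℚ else 0ℚ)

comprehend : {A : Set} {P : A → Set} → Decidable P → List A → List [ x ∈ A ∣ P x ]
comprehend P? []       = []
comprehend P? (x ∷ xs) with P? x
... | yes p = (x , [ p ]) ∷ comprehend P? xs
... | no  _ = comprehend P? xs

subsets : ∀ n → List (Subset n)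
subsets zero    = Vec.[] ∷ []
subsets (suc n) = map (outside Vec.∷_) (subsets n) ++ map (inside Vec.∷_) (subsets n)

-- The complete complex.  Refinement types carry irrelevant proofs, so a
-- face or an edge is determined by its underlying sets, and functions on
-- them depend only on those sets.

𝒞 : ℕ → ℕ → Set
𝒞 n t = [ u ∈ Subset n ∣ size u ≡ t ]

faces : ∀ n t → List (𝒞 n t)
faces n t = comprehend (λ u → size u ℕ.≟ t) (subsets n)

Disjoint : ∀ {n} → Subset n → Subset n → Set
Disjoint p q = Empty (p ∩ q)

disjoint? : ∀ {n} (p q : Subset n) → Dec (Disjoint p q)
disjoint? p q = ¬? (nonempty? (p ∩ q))

disjoint-sym : ∀ {n} (p q : Subset n) → Disjoint p q → Disjoint q p
disjoint-sym p q = subst Empty (∩-comm p q)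

IsEdge : ∀ {n t} → 𝒞 n t × 𝒞 n t → Set
IsEdge (u , v) = Disjoint (value u) (value v)

E : ℕ → ℕ → Set
E n t = [ e ∈ 𝒞 n t × 𝒞 n t ∣ IsEdge e ]

edges : ∀ n t → List (E n t)
edges n t = comprehend (λ (u , v) → disjoint? (value u) (value v))
                       (cartesianProduct (faces n t) (faces n t))

source target : ∀ {n t} → E n t → 𝒞 n t
source e = proj₁ (value e)
target e = proj₂ (value e)

reverse : ∀ {n t} → E n t → E n t
reverse ((u , v) , d) = (v , u) , Irr.map (disjoint-sym (value u) (value v)) d

Splits : ∀ {n t} → Subset n → 𝒞 n t × 𝒞 n t × 𝒞 n t → Set
Splits T (u , v , w) =
    (IsEdge (u , v) × IsEdge (v , w) × IsEdge (u , w))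
  × value u ∪ value v ∪ value w ≡ T

splits? : ∀ {n t} (T : Subset n) → Decidable (Splits {n} {t} T)
splits? T (u , v , w) =
        (disjoint? (value u) (value v)
  ×-dec disjoint? (value v) (value w)
  ×-dec disjoint? (value u) (value w))
  ×-dec Vec.≡-dec Bool._≟_ (value u ∪ value v ∪ value w) T

Splitting : ∀ n t → Subset n → Set
Splitting n t T = [ s ∈ 𝒞 n t × 𝒞 n t × 𝒞 n t ∣ Splits T s ]

splittings : ∀ n t (T : Subset n) → List (Splitting n t T)
splittings n t T =
  comprehend (splits? T)
             (cartesianProduct (faces n t) (cartesianProduct (faces n t) (faces n t)))

edge-uv edge-vw edge-uw : ∀ {n t T} → Splitting n t T → E n t
edge-uv ((u , v , w) , d) = (u , v) , Irr.map (proj₁ ∘ proj₁) d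
edge-vw ((u , v , w) , d) = (v , w) , Irr.map (proj₁ ∘ proj₂ ∘ proj₁) d
edge-uw ((u , v , w) , d) = (u , w) , Irr.map (proj₂ ∘ proj₂ ∘ proj₁) d

-- The symmetric group S_m, with στ the composite "first τ, then σ"
-- (the library's _∘ₚ_ composes in the opposite order)

S : ℕ → Set
S = Permutation′

infixl 7 _·_
_·_ : ∀ {m} → S m → S m → S m
σ · τ = τ ∘ₚ σ

infix 8 _⁻¹
_⁻¹ : ∀ {m} → S m → S m
σ ⁻¹ = flip σ

infix 6 _≈ₚ?_
_≈ₚ?_ : ∀ {m} (σ τ : S m) → Dec (σ ≈ₚ τ)
σ ≈ₚ? τ = all? (λ i → (σ ⟨$⟩ʳ i) Fin.≟ (τ ⟨$⟩ʳ i))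

IsAntisymmetric : ∀ {n t m} → (E n t → S m) → Set
IsAntisymmetric π = ∀ e → π e ≈ₚ π (reverse e) ⁻¹

-- Two-stage sampling: a uniform 3t-set T, then a uniform splitting of T.
Pr-triangle : ∀ {n t m} → (E n t → S m) → ℚ
Pr-triangle {n} {t} π =
  𝔼 (faces n (3 ℕ.* t)) λ T →
    Pr (splittings n t (value T))
       (λ s → (π (edge-uv s) · π (edge-vw s)) ≈ₚ? π (edge-uw s))

ConsistentOnTriangles : ∀ {n t m} → ℝ → (E n t → S m) → Set
ConsistentOnTriangles ξ π = 1ᴿ -ᴿ ξ ≤ᴿ fromℚ (Pr-triangle π)

Pr-coboundary : ∀ {n t m} → (E n t → S m) → (𝒞 n t → S m) → ℚ
Pr-coboundary {n} {t} π g =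
  Pr (edges n t) (λ e → π e ≈ₚ? (g (source e) · g (target e) ⁻¹))

IsUGCoboundaryExpander : (n m r : ℕ) (ξ c : ℝ) → Set
IsUGCoboundaryExpander n m r ξ c =
  ∀ t → t ℕ.≤ r → 3 ℕ.* t ℕ.≤ n →
  (π : E n t → S m) → IsAntisymmetric π → ConsistentOnTriangles ξ π →
  ∃[ g ] 1ᴿ -ᴿ c ≤ᴿ fromℚ (Pr-coboundary π g)

{-# OPTIONS --safe #-}
module Submission where

-- Fix a face w and put g(u) = π(u,w) for every u disjoint from w.  If u, v, w
-- are pairwise disjoint and the triangle u, v, w is consistent, then
-- π(u,v) = π(u,w) π(v,w)⁻¹ = g(u) g(v)⁻¹.  Choosing w to maximise the number of
-- consistent triangles through it, the satisfied edges are at least the average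
-- number of consistent triangles per face w.  All 3t-sets have equally many
-- splittings, so the two-stage sampling is uniform on ordered disjoint triples,
-- and the only loss is the proportion of faces w that meet a given edge u ∪ v.
-- A set of b points meets at most b C(n-1,t-1) of the C(n,t) faces, which is a
-- proportion of b t / n, so with b = 2t the loss is at most 2t²/n ≤ 4t²/(n+1),
-- and ε(n) = 4 r(n)²/(n+1) works.

open import Defs
import Data.Bool.Properties as Bool
open import Data.Bool.Base using (Bool; true; false; if_then_else_; _∧_; _∨_)
import Data.Fin.Base as Fin
open import Data.Fin.Permutation as Perm using (_⟨$⟩ʳ_; _⟨$⟩ˡ_; inverseʳ) renaming (_≈_ to _≈ₚ_)
open import Data.Fin.Subset using (Subset; inside; outside; ∁; _∪_; ⊥) renaming (∣_∣ to size)
open import Data.Fin.Subset.Properties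
  using (drop-∷-Empty; x∈p∩q⁺; x∈p∩q⁻; x∈p∪q⁺; x∈p∪q⁻; ∣∁p∣≡n∸∣p∣; ∉⊥; ∣⊥∣≡0)
import Data.Integer.Base as ℤ
import Data.Integer.Properties as ℤ
open import Data.Irrelevant using ([_])
open import Data.List.Base using (List; []; _∷_; _++_; foldr; map; length; cartesianProduct)
open import Data.List.Properties using (map-++; map-∘)
open import Data.Nat.Base as ℕ using (ℕ; zero; suc)
open import Data.Nat.Combinatorics using (_C_; nCk+nC[k+1]≡[n+1]C[k+1])
open import Data.Nat.ListAction using (sum)
open import Data.Nat.ListAction.Properties using (sum-++)
import Data.Nat.Properties as ℕ
import Data.Nat.Solver as ℕ-Solver
open import Data.Product.Base using (∃-syntax; _×_; _,_; proj₁; proj₂)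
open import Data.Rational.Unnormalised.Base as ℚᵘ using (mkℚᵘ)
import Data.Rational.Unnormalised.Properties as ℚᵘ
open import Data.Refinement using (Refinement-syntax; value; _,_)
open import Data.Sum.Base using (inj₁; inj₂; [_,_]′)
open import Data.Vec.Base using ([]; _∷_; here; there)
import Data.Vec.Properties as Vec
open import Function.Base using (_∘_)
open import Relation.Binary.PropositionalEquality
open import Relation.Nullary using (Dec; yes; no; does; ¬_; contradiction; recompute)
open import Relation.Nullary.Decidable using (_×-dec_; dec-true; dec-false)
open import Relation.Unary using (Decidable)

private variable
  A B D I P Q : Set
  n t m : ℕ

module Counting where

  open import Data.Nat.Base hiding (ℕ; zero; suc)
  open import Data.Nat.Properties
  open ℕ-Solver using (module +-*-Solver)

  -- Sums over lists and indicators

  infix 5 ∑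
  ∑ : List A → (A → ℕ) → ℕ
  ∑ xs f = sum (map f xs)

  syntax ∑ xs (λ x → e) = ∑[ x ∈ xs ] e

  ∑-cong : (xs : List A) {f g : A → ℕ} → (∀ x → f x ≡ g x) → ∑ xs f ≡ ∑ xs g
  ∑-cong []       f≗g = refl
  ∑-cong (x ∷ xs) f≗g = cong₂ _+_ (f≗g x) (∑-cong xs f≗g)

  ∑-mono-≤ : (xs : List A) {f g : A → ℕ} → (∀ x → f x ≤ g x) → ∑ xs f ≤ ∑ xs g
  ∑-mono-≤ []       f≤g = z≤n
  ∑-mono-≤ (x ∷ xs) f≤g = +-mono-≤ (f≤g x) (∑-mono-≤ xs f≤g)

  ∑-++ : (xs ys : List A) (f : A → ℕ) → ∑ (xs ++ ys) f ≡ ∑ xs f + ∑ ys f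
  ∑-++ xs ys f = trans (cong sum (map-++ f xs ys)) (sum-++ (map f xs) (map f ys))

  ∑-map : (h : A → B) (xs : List A) (f : B → ℕ) → ∑ (map h xs) f ≡ ∑ xs (f ∘ h)
  ∑-map h xs f = cong sum (sym (map-∘ xs))

  ∑-const : (xs : List A) (c : ℕ) → ∑[ x ∈ xs ] c ≡ length xs * c
  ∑-const []       c = refl
  ∑-const (x ∷ xs) c = cong (c +_) (∑-const xs c)

  ∑-0 : (xs : List A) → ∑[ x ∈ xs ] 0 ≡ 0
  ∑-0 xs = trans (∑-const xs 0) (*-zeroʳ (length xs))

  ∑-1 : (xs : List A) → ∑[ x ∈ xs ] 1 ≡ length xs
  ∑-1 xs = trans (∑-const xs 1) (*-identityʳ (length xs))

  ∑-+ : (xs : List A) (f g : A → ℕ) → ∑[ x ∈ xs ] (f x + g x) ≡ ∑ xs f + ∑ xs g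
  ∑-+ []       f g = refl
  ∑-+ (x ∷ xs) f g rewrite ∑-+ xs f g = interchange (f x) (g x) (∑ xs f) (∑ xs g)
    where
    interchange : ∀ a b c d → (a + b) + (c + d) ≡ (a + c) + (b + d)
    interchange = solve 4 (λ a b c d → (a :+ b) :+ (c :+ d) := (a :+ c) :+ (b :+ d)) refl
      where open +-*-Solver

  ∑-*ˡ : (c : ℕ) (xs : List A) (f : A → ℕ) → ∑[ x ∈ xs ] (c * f x) ≡ c * ∑ xs f
  ∑-*ˡ c []       f = sym (*-zeroʳ c)
  ∑-*ˡ c (x ∷ xs) f = trans (cong (c * f x +_) (∑-*ˡ c xs f)) (sym (*-distribˡ-+ c (f x) (∑ xs f)))

  ∑-*ʳ : (c : ℕ) (xs : List A) (f : A → ℕ) → ∑[ x ∈ xs ] (f x * c) ≡ ∑ xs f * c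
  ∑-*ʳ c xs f = trans (∑-cong xs (λ x → *-comm (f x) c)) (trans (∑-*ˡ c xs f) (*-comm c (∑ xs f)))

  ∑-swap : (xs : List A) (ys : List B) (f : A → B → ℕ) →
    ∑[ x ∈ xs ] ∑[ y ∈ ys ] f x y ≡ ∑[ y ∈ ys ] ∑[ x ∈ xs ] f x y
  ∑-swap []       ys f = sym (∑-0 ys)
  ∑-swap (x ∷ xs) ys f =
    trans (cong (∑ ys (f x) +_) (∑-swap xs ys f)) (sym (∑-+ ys (f x) (λ y → ∑[ x ∈ xs ] f x y)))

  ∑-× : (xs : List A) (ys : List B) (f : A × B → ℕ) →
    ∑ (cartesianProduct xs ys) f ≡ ∑[ x ∈ xs ] ∑[ y ∈ ys ] f (x , y)
  ∑-× []       ys f = refl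
  ∑-× (x ∷ xs) ys f = trans (∑-++ (map (x ,_) ys) (cartesianProduct xs ys) f)
    (cong₂ _+_ (∑-map (x ,_) ys f) (∑-× xs ys f))

  -- The averaging step that later selects the pivot. The recursion starts from `x₀`, so a witness
  -- exists even for the empty list.
  ∑-maximum : (x₀ : A) (xs : List A) (f : A → ℕ) → ∃[ x ] ∑ xs f ≤ length xs * f x
  ∑-maximum x₀ []       f = x₀ , z≤n
  ∑-maximum x₀ (y ∷ xs) f with ∑-maximum x₀ xs f
  ... | x , ∑≤ with ≤-total (f y) (f x)
  ...   | inj₁ fy≤fx = x , +-mono-≤ fy≤fx ∑≤
  ...   | inj₂ fx≤fy = y , +-monoʳ-≤ (f y) (≤-trans ∑≤ (*-monoʳ-≤ (length xs) fx≤fy))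

  𝟙 : Dec P → ℕ
  𝟙 P? = if does P? then 1 else 0

  𝟙-yes : (P? : Dec P) → P → 𝟙 P? ≡ 1
  𝟙-yes P? p rewrite dec-true P? p = refl

  𝟙-no : (P? : Dec P) → ¬ P → 𝟙 P? ≡ 0
  𝟙-no P? ¬p rewrite dec-false P? ¬p = refl

  𝟙-mono : (P? : Dec P) (Q? : Dec Q) → (P → Q) → 𝟙 P? ≤ 𝟙 Q?
  𝟙-mono (yes p) Q? p⇒q = ≤-reflexive (sym (𝟙-yes Q? (p⇒q p)))
  𝟙-mono (no _)  Q? p⇒q = z≤n

  𝟙-cong : (P? : Dec P) (Q? : Dec Q) → (P → Q) → (Q → P) → 𝟙 P? ≡ 𝟙 Q?
  𝟙-cong P? Q? p⇒q q⇒p = ≤-antisym (𝟙-mono P? Q? p⇒q) (𝟙-mono Q? P? q⇒p)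

  𝟙-× : (P? : Dec P) (Q? : Dec Q) → 𝟙 (P? ×-dec Q?) ≡ 𝟙 P? * 𝟙 Q?
  𝟙-× (yes _) (yes _) = refl
  𝟙-× (yes _) (no _)  = refl
  𝟙-× (no _)  _       = refl

  𝟙-absorb : (P? : Dec P) {a : ℕ} → (¬ P → a ≡ 0) → 𝟙 P? * a ≡ a
  𝟙-absorb (yes _) _    = +-identityʳ _
  𝟙-absorb (no ¬p) off = sym (off ¬p)

  -- Carries sums over a refinement type to the ambient list: `g` extends `f` by zero, so the
  -- elements filtered out contribute nothing.
  ∑-comprehend : {P : A → Set} (P? : Decidable P) (xs : List A)
    (f : [ x ∈ A ∣ P x ] → ℕ) (g : A → ℕ) →
    (∀ x (p : P x) → f (x , [ p ]) ≡ g x) → (∀ x → ¬ P x → g x ≡ 0) →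
    ∑ (comprehend P? xs) f ≡ ∑ xs g
  ∑-comprehend P? []       f g on off = refl
  ∑-comprehend P? (x ∷ xs) f g on off with P? x
  ... | yes p = cong₂ _+_ (on x p) (∑-comprehend P? xs f g on off)
  ... | no ¬p = trans (∑-comprehend P? xs f g on off) (cong (_+ ∑ xs g) (sym (off x ¬p)))

  ∑-comprehend-≥ : {P : A → Set} (P? : Decidable P) (xs : List A)
    (f : [ x ∈ A ∣ P x ] → ℕ) (g : A → ℕ) →
    (∀ x (p : P x) → g x ≤ f (x , [ p ])) → (∀ x → ¬ P x → g x ≡ 0) →
    ∑ xs g ≤ ∑ (comprehend P? xs) f
  ∑-comprehend-≥ P? []       f g on off = z≤n
  ∑-comprehend-≥ P? (x ∷ xs) f g on off with P? x
  ... | yes p = +-mono-≤ (on x p) (∑-comprehend-≥ P? xs f g on off)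
  ... | no ¬p = ≤-trans (≤-reflexive (cong (_+ ∑ xs g) (off x ¬p))) (∑-comprehend-≥ P? xs f g on off)

  -- Counting faces and splittings

  sides : List Bool
  sides = outside ∷ inside ∷ []

  -- The inductions on `n` go through this: the membership of the first vertex becomes an outer sum
  -- over two values.
  ∑-subsets : ∀ n (f : Subset (suc n) → ℕ) →
    ∑ (subsets (suc n)) f ≡ ∑[ x ∈ sides ] ∑[ u ∈ subsets n ] f (x ∷ u)
  ∑-subsets n f = trans (∑-++ (map (outside ∷_) (subsets n)) (map (inside ∷_) (subsets n)) f)
    (cong₂ _+_ (∑-map (outside ∷_) (subsets n) f)
      (trans (∑-map (inside ∷_) (subsets n) f) (sym (+-identityʳ _))))

  ∑-faces : ∀ n t (h : Subset n → ℕ) →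
    ∑ (faces n t) (h ∘ value) ≡ ∑[ u ∈ subsets n ] 𝟙 (size u ≟ t) * h u
  ∑-faces n t h = ∑-comprehend (λ u → size u ≟ t) (subsets n) (h ∘ value) _
    (λ u p → sym (trans (cong (_* h u) (𝟙-yes (size u ≟ t) p)) (+-identityʳ (h u))))
    (λ u ¬p → cong (_* h u) (𝟙-no (size u ≟ t) ¬p))

  -- The size proof stored in a face is irrelevant; it is recovered because equality of numbers is
  -- decidable.
  𝒞-size : (u : 𝒞 n t) → size (value u) ≡ t
  𝒞-size {t = t} (u , [ p ]) = recompute (size u ≟ t) p

  Disjoint-∷⁺ : ∀ {x y} {u v : Subset n} → x ∧ y ≡ outside → Disjoint u v → Disjoint (x ∷ u) (y ∷ v)
  Disjoint-∷⁺ {x = false}              _ d (Fin.suc i , there i∈) = d (i , i∈)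
  Disjoint-∷⁺ {x = true}  {y = false}  _ d (Fin.suc i , there i∈) = d (i , i∈)

  Disjoint-∷⁻ : ∀ {x y} {u v : Subset n} → Disjoint (x ∷ u) (y ∷ v) → x ∧ y ≡ outside × Disjoint u v
  Disjoint-∷⁻ {x = false}             d = refl , drop-∷-Empty d
  Disjoint-∷⁻ {x = true}  {y = false} d = refl , drop-∷-Empty d
  Disjoint-∷⁻ {x = true}  {y = true}  d = contradiction (Fin.zero , here) d

  Disjoint-∪⁺ : (u v w : Subset n) → Disjoint u w → Disjoint v w → Disjoint (u ∪ v) w
  Disjoint-∪⁺ u v w d e (i , i∈) with x∈p∩q⁻ (u ∪ v) w i∈
  ... | i∈u∪v , i∈w = [ (λ i∈u → d (i , x∈p∩q⁺ (i∈u , i∈w))) , (λ i∈v → e (i , x∈p∩q⁺ (i∈v , i∈w))) ]′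
    (x∈p∪q⁻ u v i∈u∪v)

  Disjoint-∪⁻ : (u v w : Subset n) → Disjoint (u ∪ v) w → Disjoint u w × Disjoint v w
  Disjoint-∪⁻ u v w d =
    (λ (i , i∈) → let i∈u , i∈w = x∈p∩q⁻ u w i∈ in d (i , x∈p∩q⁺ (x∈p∪q⁺ {p = u} {v} (inj₁ i∈u) , i∈w))) ,
    (λ (i , i∈) → let i∈v , i∈w = x∈p∩q⁻ v w i∈ in d (i , x∈p∩q⁺ (x∈p∪q⁺ {p = u} {v} (inj₂ i∈v) , i∈w)))

  size-∪ : (u v : Subset n) → Disjoint u v → size (u ∪ v) ≡ size u + size v
  size-∪ []            []            d = refl
  size-∪ (outside ∷ u) (outside ∷ v) d = size-∪ u v (drop-∷-Empty d)
  size-∪ (outside ∷ u) (inside ∷ v)  d =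
    trans (cong suc (size-∪ u v (drop-∷-Empty d))) (sym (+-suc (size u) (size v)))
  size-∪ (inside ∷ u)  (outside ∷ v) d = cong suc (size-∪ u v (drop-∷-Empty d))
  size-∪ (inside ∷ u)  (inside ∷ v)  d = contradiction (Fin.zero , here) d

  -- disjointSum m F = Σₛ (m choose s) F(s).  Weighting a set w by F (size w),
  -- rather than fixing its size, lets the induction on n change only F.
  disjointSum : ℕ → (ℕ → ℕ) → ℕ
  disjointSum zero    F = F 0
  disjointSum (suc m) F = disjointSum m F + disjointSum m (F ∘ suc)

  -- A vertex of `B` must stay out of `w`, so one branch vanishes. A vertex outside `B` is free, and
  -- putting it into `w` replaces `F` by `F ∘ suc`.
  ∑-disjoint : (B : Subset n) (F : ℕ → ℕ) →
    ∑[ w ∈ subsets n ] 𝟙 (disjoint? B w) * F (size w) ≡ disjointSum (size (∁ B)) F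
  ∑-disjoint []            F = trans (+-identityʳ _) (+-identityʳ _)
  ∑-disjoint {n = suc n} (x ∷ B) F = begin
    ∑[ w ∈ subsets (suc n) ] 𝟙 (disjoint? (x ∷ B) w) * F (size w)
      ≡⟨ ∑-subsets n _ ⟩
    ∑[ y ∈ sides ] ∑[ w ∈ subsets n ] 𝟙 (disjoint? (x ∷ B) (y ∷ w)) * F (size (y ∷ w))
      ≡⟨ ∑-cong sides (λ y → ∑-cong (subsets n) (λ w → cong (_* F (size (y ∷ w)))
           (trans (𝟙-cong (disjoint? (x ∷ B) (y ∷ w)) (x ∧ y Bool.≟ outside ×-dec disjoint? B w)
                    (Disjoint-∷⁻ {x = x} {y}) (λ (p , q) → Disjoint-∷⁺ {x = x} {y} p q))
                  (𝟙-× (x ∧ y Bool.≟ outside) (disjoint? B w))))) ⟩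
    ∑[ y ∈ sides ] ∑[ w ∈ subsets n ] 𝟙 (x ∧ y Bool.≟ outside) * 𝟙 (disjoint? B w) * F (size (y ∷ w))
      ≡⟨ head x ⟩
    disjointSum (size (∁ (x ∷ B))) F ∎
    where
    open ≡-Reasoning
    term : ∀ F → ∑[ w ∈ subsets n ] (𝟙 (disjoint? B w) + 0) * F (size w) ≡ disjointSum (size (∁ B)) F
    term F = trans (∑-cong (subsets n) (λ w → cong (_* F (size w)) (+-identityʳ (𝟙 (disjoint? B w))))) (∑-disjoint B F)
    head : ∀ x → ∑[ y ∈ sides ] ∑[ w ∈ subsets n ]
        𝟙 (x ∧ y Bool.≟ outside) * 𝟙 (disjoint? B w) * F (size (y ∷ w))
      ≡ disjointSum (size (∁ (x ∷ B))) F
    head outside = cong₂ _+_ (term F) (trans (+-identityʳ _) (term (F ∘ suc)))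
    head inside  = trans (cong₂ _+_ (term F) (trans (+-identityʳ _) (∑-0 (subsets n)))) (+-identityʳ _)

  disjointSum-0 : ∀ m → disjointSum m (λ _ → 0) ≡ 0
  disjointSum-0 zero    = refl
  disjointSum-0 (suc m) = cong₂ _+_ (disjointSum-0 m) (disjointSum-0 m)

  -- Shifting the weight lowers the target size by one, so the recursion of `disjointSum` is
  -- Pascal's rule. At target 0 the shifted weight vanishes.
  disjointSum-𝟙 : ∀ m t → disjointSum m (λ s → 𝟙 (s ≟ t)) ≡ m C t
  disjointSum-𝟙 zero    zero    = refl
  disjointSum-𝟙 zero    (suc t) = refl
  disjointSum-𝟙 (suc m) zero    = cong₂ _+_ (disjointSum-𝟙 m 0) (disjointSum-0 m)
  disjointSum-𝟙 (suc m) (suc t) = trans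
    (cong₂ _+_ (disjointSum-𝟙 m (suc t)) (disjointSum-𝟙 m t))
    (trans (+-comm (m C suc t) (m C t)) (nCk+nC[k+1]≡[n+1]C[k+1] m t))

  -- Here `w` ranges over the `t`-subsets of the complement of `B`. Taking `B` to be empty, a face,
  -- or the union of an edge gives the counts of faces, edges and triangles.
  ∑-faces-disjoint : ∀ n t (B : Subset n) →
    ∑[ w ∈ faces n t ] 𝟙 (disjoint? B (value w)) ≡ (n ∸ size B) C t
  ∑-faces-disjoint n t B = begin
    ∑[ w ∈ faces n t ] 𝟙 (disjoint? B (value w))
      ≡⟨ ∑-faces n t (λ w → 𝟙 (disjoint? B w)) ⟩
    ∑[ w ∈ subsets n ] 𝟙 (size w ≟ t) * 𝟙 (disjoint? B w)
      ≡⟨ ∑-cong (subsets n) (λ w → *-comm (𝟙 (size w ≟ t)) _) ⟩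
    ∑[ w ∈ subsets n ] 𝟙 (disjoint? B w) * 𝟙 (size w ≟ t)
      ≡⟨ ∑-disjoint B (λ s → 𝟙 (s ≟ t)) ⟩
    disjointSum (size (∁ B)) (λ s → 𝟙 (s ≟ t))
      ≡⟨ disjointSum-𝟙 (size (∁ B)) t ⟩
    size (∁ B) C t
      ≡⟨ cong (_C t) (∣∁p∣≡n∸∣p∣ B) ⟩
    (n ∸ size B) C t ∎
    where open ≡-Reasoning

  ∑-≡ : (U : Subset n) (h : Subset n → ℕ) → ∑[ T ∈ subsets n ] 𝟙 (Vec.≡-dec Bool._≟_ U T) * h T ≡ h U
  ∑-≡ []      h = trans (+-identityʳ _) (+-identityʳ _)
  ∑-≡ {n = suc n} (x ∷ U) h = begin
    ∑[ T ∈ subsets (suc n) ] 𝟙 (Vec.≡-dec Bool._≟_ (x ∷ U) T) * h T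
      ≡⟨ ∑-subsets n _ ⟩
    ∑[ y ∈ sides ] ∑[ T ∈ subsets n ] 𝟙 (Vec.≡-dec Bool._≟_ (x ∷ U) (y ∷ T)) * h (y ∷ T)
      ≡⟨ ∑-cong sides (λ y → ∑-cong (subsets n) (λ T → trans (cong (_* h (y ∷ T))
           (trans (𝟙-cong (Vec.≡-dec Bool._≟_ (x ∷ U) (y ∷ T)) (x Bool.≟ y ×-dec Vec.≡-dec Bool._≟_ U T)
                    Vec.∷-injective (λ (p , q) → cong₂ _∷_ p q))
                  (𝟙-× (x Bool.≟ y) (Vec.≡-dec Bool._≟_ U T))))
           (*-assoc (𝟙 (x Bool.≟ y)) _ _))) ⟩
    ∑[ y ∈ sides ] ∑[ T ∈ subsets n ] 𝟙 (x Bool.≟ y) * (𝟙 (Vec.≡-dec Bool._≟_ U T) * h (y ∷ T))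
      ≡⟨ ∑-cong sides (λ y → trans (∑-*ˡ (𝟙 (x Bool.≟ y)) (subsets n) _)
           (cong (𝟙 (x Bool.≟ y) *_) (∑-≡ U (h ∘ (y ∷_))))) ⟩
    ∑[ y ∈ sides ] 𝟙 (x Bool.≟ y) * h (y ∷ U)
      ≡⟨ head x ⟩
    h (x ∷ U) ∎
    where
    open ≡-Reasoning
    head : ∀ x → ∑[ y ∈ sides ] 𝟙 (x Bool.≟ y) * h (y ∷ U) ≡ h (x ∷ U)
    head outside = trans (+-identityʳ _) (+-identityʳ _)
    head inside  = trans (+-identityʳ _) (+-identityʳ _)

  ∑-faces-≡ : ∀ n t (U : Subset n) → size U ≡ t →
    ∑[ T ∈ faces n t ] 𝟙 (Vec.≡-dec Bool._≟_ U (value T)) ≡ 1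
  ∑-faces-≡ n t U |U|≡t = begin
    ∑[ T ∈ faces n t ] 𝟙 (Vec.≡-dec Bool._≟_ U (value T))
      ≡⟨ ∑-faces n t _ ⟩
    ∑[ T ∈ subsets n ] 𝟙 (size T ≟ t) * 𝟙 (Vec.≡-dec Bool._≟_ U T)
      ≡⟨ ∑-cong (subsets n) (λ T → *-comm (𝟙 (size T ≟ t)) _) ⟩
    ∑[ T ∈ subsets n ] 𝟙 (Vec.≡-dec Bool._≟_ U T) * 𝟙 (size T ≟ t)
      ≡⟨ ∑-≡ U (λ T → 𝟙 (size T ≟ t)) ⟩
    𝟙 (size U ≟ t)
      ≡⟨ 𝟙-yes (size U ≟ t) |U|≡t ⟩
    1 ∎
    where open ≡-Reasoning

  -- Ordered triples of faces and splittings of a set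

  ∑³ : List A → List B → List D → (A → B → D → ℕ) → ℕ
  ∑³ xs ys zs f = ∑[ x ∈ xs ] ∑[ y ∈ ys ] ∑[ z ∈ zs ] f x y z

  ∑³-cong : (xs : List A) (ys : List B) (zs : List D) {f g : A → B → D → ℕ} →
    (∀ x y z → f x y z ≡ g x y z) → ∑³ xs ys zs f ≡ ∑³ xs ys zs g
  ∑³-cong xs ys zs f≗g = ∑-cong xs (λ x → ∑-cong ys (λ y → ∑-cong zs (λ z → f≗g x y z)))

  ∑³-*ˡ : (c : ℕ) (xs : List A) (ys : List B) (zs : List D) (f : A → B → D → ℕ) →
    ∑³ xs ys zs (λ x y z → c * f x y z) ≡ c * ∑³ xs ys zs f
  ∑³-*ˡ c xs ys zs f = trans
    (∑-cong xs (λ x → trans (∑-cong ys (λ y → ∑-*ˡ c zs (f x y))) (∑-*ˡ c ys _)))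
    (∑-*ˡ c xs _)

  ∑-swap³ : (ts : List I) (xs : List A) (ys : List B) (zs : List D) (f : I → A → B → D → ℕ) →
    ∑[ t ∈ ts ] ∑³ xs ys zs (f t) ≡ ∑³ xs ys zs (λ x y z → ∑[ t ∈ ts ] f t x y z)
  ∑-swap³ ts xs ys zs f = trans (∑-swap ts xs _)
    (∑-cong xs (λ x → trans (∑-swap ts ys _) (∑-cong ys (λ y → ∑-swap ts zs _))))

  -- Peels the first vertex off all three sets, then exchanges sums so that the three memberships
  -- come outermost, as the induction in `∑-partition` requires.
  ∑³-subsets : ∀ n (f : Subset (suc n) → Subset (suc n) → Subset (suc n) → ℕ) →
    let 𝒮 = subsets (suc n); 𝒮′ = subsets n in
    ∑³ 𝒮 𝒮 𝒮 f ≡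
    ∑³ sides sides sides (λ x y z → ∑³ 𝒮′ 𝒮′ 𝒮′ (λ u v w → f (x ∷ u) (y ∷ v) (z ∷ w)))
  ∑³-subsets n f = begin
    ∑³ 𝒮 𝒮 𝒮 f
      ≡⟨ trans (∑-cong 𝒮 (λ u → trans (∑-cong 𝒮 (λ v → ∑-subsets n _)) (∑-subsets n _))) (∑-subsets n _) ⟩
    ∑[ x ∈ sides ] ∑[ u ∈ 𝒮′ ] ∑[ y ∈ sides ] ∑[ v ∈ 𝒮′ ] ∑[ z ∈ sides ] ∑[ w ∈ 𝒮′ ] f (x ∷ u) (y ∷ v) (z ∷ w)
      ≡⟨ ∑-cong sides (λ x → trans
           (∑-cong 𝒮′ (λ u → ∑-cong sides (λ y → ∑-swap 𝒮′ sides (λ v z → ∑[ w ∈ 𝒮′ ] f (x ∷ u) (y ∷ v) (z ∷ w)))))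
           (trans (∑-swap 𝒮′ sides (λ u y → ∑[ z ∈ sides ] ∑[ v ∈ 𝒮′ ] ∑[ w ∈ 𝒮′ ] f (x ∷ u) (y ∷ v) (z ∷ w)))
             (∑-cong sides (λ y → ∑-swap 𝒮′ sides (λ u z → ∑[ v ∈ 𝒮′ ] ∑[ w ∈ 𝒮′ ] f (x ∷ u) (y ∷ v) (z ∷ w)))))) ⟩
    ∑³ sides sides sides (λ x y z → ∑³ 𝒮′ 𝒮′ 𝒮′ (λ u v w → f (x ∷ u) (y ∷ v) (z ∷ w))) ∎
    where
    open ≡-Reasoning
    𝒮 = subsets (suc n)
    𝒮′ = subsets n

  Disjoint₃ : Subset n → Subset n → Subset n → Set
  Disjoint₃ u v w = Disjoint u v × Disjoint v w × Disjoint u w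

  disjoint₃? : (u v w : Subset n) → Dec (Disjoint₃ u v w)
  disjoint₃? u v w = disjoint? u v ×-dec disjoint? v w ×-dec disjoint? u w

  Partition : (T u v w : Subset n) → Set
  Partition T u v w = Disjoint₃ u v w × u ∪ v ∪ w ≡ T

  partition? : (T u v w : Subset n) → Dec (Partition T u v w)
  partition? T u v w = disjoint₃? u v w ×-dec Vec.≡-dec Bool._≟_ (u ∪ v ∪ w) T

  SidePartition : (t x y z : Bool) → Set
  SidePartition t x y z =
    (x ∧ y ≡ outside × y ∧ z ≡ outside × x ∧ z ≡ outside) × x ∨ y ∨ z ≡ t

  sidePartition? : (t x y z : Bool) → Dec (SidePartition t x y z)
  sidePartition? t x y z =
    (x ∧ y Bool.≟ outside ×-dec y ∧ z Bool.≟ outside ×-dec x ∧ z Bool.≟ outside)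
    ×-dec (x ∨ y ∨ z Bool.≟ t)

  -- Disjointness and the union are conditions vertex by vertex, so the indicator factors into the
  -- first vertex and the rest.
  𝟙-partition-∷ : ∀ t x y z (T u v w : Subset n) →
    𝟙 (partition? (t ∷ T) (x ∷ u) (y ∷ v) (z ∷ w)) ≡ 𝟙 (sidePartition? t x y z) * 𝟙 (partition? T u v w)
  𝟙-partition-∷ t x y z T u v w = trans
    (𝟙-cong (partition? (t ∷ T) (x ∷ u) (y ∷ v) (z ∷ w)) (sidePartition? t x y z ×-dec partition? T u v w) to from)
    (𝟙-× (sidePartition? t x y z) (partition? T u v w))
    where
    to : Partition (t ∷ T) (x ∷ u) (y ∷ v) (z ∷ w) → SidePartition t x y z × Partition T u v w
    to ((d , e , f) , ∪≡) =
      let dₕ , dₜ = Disjoint-∷⁻ {x = x} {y} d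
          eₕ , eₜ = Disjoint-∷⁻ {x = y} {z} e
          fₕ , fₜ = Disjoint-∷⁻ {x = x} {z} f
          ∪ₕ , ∪ₜ = Vec.∷-injective ∪≡
      in ((dₕ , eₕ , fₕ) , ∪ₕ) , ((dₜ , eₜ , fₜ) , ∪ₜ)
    from : SidePartition t x y z × Partition T u v w → Partition (t ∷ T) (x ∷ u) (y ∷ v) (z ∷ w)
    from (((dₕ , eₕ , fₕ) , ∪ₕ) , ((dₜ , eₜ , fₜ) , ∪ₜ)) =
      ( Disjoint-∷⁺ {x = x} {y} dₕ dₜ
      , Disjoint-∷⁺ {x = y} {z} eₕ eₜ
      , Disjoint-∷⁺ {x = x} {z} fₕ fₜ ) , cong₂ _∷_ ∪ₕ ∪ₜ

  grow : Bool → ℕ → ℕ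
  grow x a = if x then suc a else a

  size-∷ : ∀ x (u : Subset n) → size (x ∷ u) ≡ grow x (size u)
  size-∷ outside u = refl
  size-∷ inside  u = refl

  growBy : (x y z : Bool) → (ℕ → ℕ → ℕ → ℕ) → ℕ → ℕ → ℕ → ℕ
  growBy x y z F a b c = F (grow x a) (grow y b) (grow z c)

  -- Only the fact that the sum over the partitions of T depends on nothing but
  -- size T is used, so the multinomial coefficients need not be evaluated.
  partitionSum : ℕ → (ℕ → ℕ → ℕ → ℕ) → ℕ
  partitionSum zero    F = F 0 0 0
  partitionSum (suc s) F = ∑³ sides sides sides (λ x y z →
    𝟙 (sidePartition? inside x y z) * partitionSum s (growBy x y z F))

  -- Induction over the vertices. A vertex of `T` goes to exactly one of `u`, `v`, `w` and raises
  -- that argument of `F` by one; a vertex outside `T` goes to none and leaves `F` unchanged.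
  ∑-partition : (T : Subset n) (F : ℕ → ℕ → ℕ → ℕ) →
    ∑³ (subsets n) (subsets n) (subsets n) (λ u v w → 𝟙 (partition? T u v w) * F (size u) (size v) (size w))
    ≡ partitionSum (size T) F
  ∑-partition []      F = trans (+-identityʳ _) (trans (+-identityʳ _) (trans (+-identityʳ _) (+-identityʳ _)))
  ∑-partition {n = suc n} (t ∷ T) F = begin
    ∑³ 𝒮 𝒮 𝒮 (λ u v w → 𝟙 (partition? (t ∷ T) u v w) * F (size u) (size v) (size w))
      ≡⟨ ∑³-subsets n _ ⟩
    ∑³ sides sides sides (λ x y z → ∑³ 𝒮′ 𝒮′ 𝒮′ (λ u v w →
      𝟙 (partition? (t ∷ T) (x ∷ u) (y ∷ v) (z ∷ w)) * F (size (x ∷ u)) (size (y ∷ v)) (size (z ∷ w))))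
      ≡⟨ ∑³-cong sides sides sides (λ x y z → ∑³-cong 𝒮′ 𝒮′ 𝒮′ (λ u v w → trans
           (cong₂ _*_ (𝟙-partition-∷ t x y z T u v w) (F-size x y z u v w))
           (*-assoc (𝟙 (sidePartition? t x y z)) _ _))) ⟩
    ∑³ sides sides sides (λ x y z → ∑³ 𝒮′ 𝒮′ 𝒮′ (λ u v w →
      𝟙 (sidePartition? t x y z) * (𝟙 (partition? T u v w) * growBy x y z F (size u) (size v) (size w))))
      ≡⟨ ∑³-cong sides sides sides (λ x y z → trans
           (∑³-*ˡ (𝟙 (sidePartition? t x y z)) 𝒮′ 𝒮′ 𝒮′ _)
           (cong (𝟙 (sidePartition? t x y z) *_) (∑-partition T (growBy x y z F)))) ⟩
    ∑³ sides sides sides (λ x y z → 𝟙 (sidePartition? t x y z) * partitionSum (size T) (growBy x y z F))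
      ≡⟨ head t ⟩
    partitionSum (size (t ∷ T)) F ∎
    where
    open ≡-Reasoning
    𝒮 = subsets (suc n)
    𝒮′ = subsets n
    F-size : ∀ x y z (u v w : Subset n) →
      F (size (x ∷ u)) (size (y ∷ v)) (size (z ∷ w)) ≡ growBy x y z F (size u) (size v) (size w)
    F-size x y z u v w rewrite size-∷ x u | size-∷ y v | size-∷ z w = refl
    head : ∀ t → ∑³ sides sides sides (λ x y z →
        𝟙 (sidePartition? t x y z) * partitionSum (size T) (growBy x y z F))
      ≡ partitionSum (size (t ∷ T)) F
    -- Of the eight cases only the one with the vertex in none of the three sets survives
    -- computation; what remains is to remove added zeros.
    head outside = trans (+-identityʳ _) (trans (+-identityʳ _) (trans (+-identityʳ _) (+-identityʳ _)))
    head inside  = refl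

  -- Gathers the three size constraints into one factor depending only on the sizes, the shape that
  -- `F` has in `∑-partition`.
  ∑³-faces : ∀ n t (h : Subset n → Subset n → Subset n → ℕ) →
    ∑³ (faces n t) (faces n t) (faces n t) (λ u v w → h (value u) (value v) (value w)) ≡
    ∑³ (subsets n) (subsets n) (subsets n) (λ u v w →
      h u v w * (𝟙 (size u ≟ t) * (𝟙 (size v ≟ t) * 𝟙 (size w ≟ t))))
  ∑³-faces n t h = begin
    ∑³ ℱ ℱ ℱ (λ u v w → h (value u) (value v) (value w))
      ≡⟨ trans (∑-cong ℱ (λ u → trans (∑-cong ℱ (λ v → ∑-faces n t (h (value u) (value v)))) (∑-faces n t _)))
               (∑-faces n t _) ⟩
    ∑[ u ∈ 𝒮 ] 𝟙 (size u ≟ t) * (∑[ v ∈ 𝒮 ] 𝟙 (size v ≟ t) * (∑[ w ∈ 𝒮 ] 𝟙 (size w ≟ t) * h u v w))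
      ≡⟨ ∑-cong 𝒮 (λ u → trans (sym (∑-*ˡ (𝟙 (size u ≟ t)) 𝒮 _)) (∑-cong 𝒮 (λ v →
           trans (cong (𝟙 (size u ≟ t) *_) (sym (∑-*ˡ (𝟙 (size v ≟ t)) 𝒮 _)))
           (trans (sym (∑-*ˡ (𝟙 (size u ≟ t)) 𝒮 _)) (∑-cong 𝒮 (λ w →
             reorder (𝟙 (size u ≟ t)) (𝟙 (size v ≟ t)) (𝟙 (size w ≟ t)) (h u v w))))))) ⟩
    ∑³ 𝒮 𝒮 𝒮 (λ u v w → h u v w * (𝟙 (size u ≟ t) * (𝟙 (size v ≟ t) * 𝟙 (size w ≟ t)))) ∎
    where
    open ≡-Reasoning
    ℱ = faces n t
    𝒮 = subsets n
    reorder : ∀ a b c d → a * (b * (c * d)) ≡ d * (a * (b * c))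
    reorder = solve 4 (λ a b c d → a :* (b :* (c :* d)) := d :* (a :* (b :* c))) refl
      where open +-*-Solver

  ∑-splittings : ∀ n t (T : Subset n) (f : Splitting n t T → ℕ) (g : 𝒞 n t → 𝒞 n t → 𝒞 n t → ℕ) →
    (∀ u v w (p : Splits T (u , v , w)) → f ((u , v , w) , [ p ]) ≡ g u v w) →
    ∑ (splittings n t T) f ≡
    ∑³ (faces n t) (faces n t) (faces n t) (λ u v w → 𝟙 (splits? T (u , v , w)) * g u v w)
  ∑-splittings n t T f g f≗g = trans
    (∑-comprehend (splits? T) (cartesianProduct ℱ (cartesianProduct ℱ ℱ)) f
      (λ (u , v , w) → 𝟙 (splits? T (u , v , w)) * g u v w)
      (λ (u , v , w) p → trans (f≗g u v w p) (sym (trans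
         (cong (_* g u v w) (𝟙-yes (splits? T (u , v , w)) p)) (+-identityʳ _))))
      (λ (u , v , w) ¬p → cong (_* g u v w) (𝟙-no (splits? T (u , v , w)) ¬p)))
    (trans (∑-× ℱ (cartesianProduct ℱ ℱ) _) (∑-cong ℱ (λ u → ∑-× ℱ ℱ _)))
    where ℱ = faces n t

  -- The multinomial coefficient (3t)!/(t!)^3, obtained by weighting partitions with the indicator
  -- that all three parts have size `t`.
  splittingCount : ℕ → ℕ
  splittingCount t = partitionSum (3 * t) (λ a b c → 𝟙 (a ≟ t) * (𝟙 (b ≟ t) * 𝟙 (c ≟ t)))

  -- Independence of `T` gives the inner averages of the two-stage sampling a common denominator.
  length-splittings : ∀ n t (T : Subset n) → size T ≡ 3 * t → length (splittings n t T) ≡ splittingCount t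
  length-splittings n t T |T|≡3t = begin
    length (splittings n t T)
      ≡⟨ ∑-1 (splittings n t T) ⟨
    ∑[ s ∈ splittings n t T ] 1
      ≡⟨ ∑-splittings n t T (λ _ → 1) (λ _ _ _ → 1) (λ _ _ _ _ → refl) ⟩
    ∑³ ℱ ℱ ℱ (λ u v w → 𝟙 (splits? T (u , v , w)) * 1)
      -- Besides dropping the factor 1, this uses that `splits?` on faces unfolds to `partition?` on
      -- the underlying sets.
      ≡⟨ ∑³-cong ℱ ℱ ℱ (λ u v w → *-identityʳ (𝟙 (splits? T (u , v , w)))) ⟩
    ∑³ ℱ ℱ ℱ (λ u v w → 𝟙 (partition? T (value u) (value v) (value w)))
      ≡⟨ ∑³-faces n t (λ u v w → 𝟙 (partition? T u v w)) ⟩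
    _
      ≡⟨ ∑-partition T _ ⟩
    partitionSum (size T) (λ a b c → 𝟙 (a ≟ t) * (𝟙 (b ≟ t) * 𝟙 (c ≟ t)))
      ≡⟨ cong (λ s → partitionSum s _) |T|≡3t ⟩
    splittingCount t ∎
    where
    open ≡-Reasoning
    ℱ = faces n t

  -- Exchange the sums: a pairwise disjoint triple is a splitting of exactly one `3 * t`-set, its
  -- union, and any other triple is a splitting of none.
  ∑-triangles : ∀ n t (f : ∀ {T} → Splitting n t T → ℕ) (g : 𝒞 n t → 𝒞 n t → 𝒞 n t → ℕ) →
    (∀ T u v w (p : Splits T (u , v , w)) → f {T} ((u , v , w) , [ p ]) ≡ g u v w) →
    ∑[ T ∈ faces n (3 * t) ] ∑ (splittings n t (value T)) f ≡
    ∑³ (faces n t) (faces n t) (faces n t) (λ u v w →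
      𝟙 (disjoint₃? (value u) (value v) (value w)) * g u v w)
  ∑-triangles n t f g f≗g = begin
    ∑[ T ∈ faces n (3 * t) ] ∑ (splittings n t (value T)) f
      ≡⟨ ∑-cong (faces n (3 * t)) (λ T → ∑-splittings n t (value T) f g (f≗g (value T))) ⟩
    ∑[ T ∈ faces n (3 * t) ] ∑³ ℱ ℱ ℱ (λ u v w → 𝟙 (splits? (value T) (u , v , w)) * g u v w)
      ≡⟨ ∑-swap³ (faces n (3 * t)) ℱ ℱ ℱ _ ⟩
    ∑³ ℱ ℱ ℱ (λ u v w → ∑[ T ∈ faces n (3 * t) ] 𝟙 (splits? (value T) (u , v , w)) * g u v w)
      ≡⟨ ∑³-cong ℱ ℱ ℱ (λ u v w → trans (∑-*ʳ (g u v w) (faces n (3 * t)) _)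
           (cong (_* g u v w) (unique u v w))) ⟩
    ∑³ ℱ ℱ ℱ (λ u v w → 𝟙 (disjoint₃? (value u) (value v) (value w)) * g u v w) ∎
    where
    open ≡-Reasoning
    ℱ = faces n t
    unique : (u v w : 𝒞 n t) → ∑[ T ∈ faces n (3 * t) ] 𝟙 (splits? (value T) (u , v , w))
      ≡ 𝟙 (disjoint₃? (value u) (value v) (value w))
    unique u′@(u , _) v′@(v , _) w′@(w , _) = trans
      (∑-cong (faces n (3 * t)) (λ T → 𝟙-× (disjoint₃? u v w) (Vec.≡-dec Bool._≟_ (u ∪ v ∪ w) (value T))))
      (trans (∑-*ˡ (𝟙 (disjoint₃? u v w)) (faces n (3 * t)) _) (only-union (disjoint₃? u v w)))
      where
      only-union : (d : Dec (Disjoint₃ u v w)) →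
        𝟙 d * (∑[ T ∈ faces n (3 * t) ] 𝟙 (Vec.≡-dec Bool._≟_ (u ∪ v ∪ w) (value T))) ≡ 𝟙 d
      only-union (no _) = refl
      only-union (yes (d , e , f)) = trans (+-identityʳ _) (∑-faces-≡ n (3 * t) (u ∪ v ∪ w) (begin
        size (u ∪ v ∪ w)
          ≡⟨ size-∪ u (v ∪ w) (disjoint-sym (v ∪ w) u
               (Disjoint-∪⁺ v w u (disjoint-sym u v d) (disjoint-sym u w f))) ⟩
        size u + size (v ∪ w)
          ≡⟨ cong (size u +_) (size-∪ v w e) ⟩
        size u + (size v + size w)
          ≡⟨ cong₂ _+_ (𝒞-size u′) (cong₂ _+_ (𝒞-size v′) (trans (𝒞-size w′) (sym (+-identityʳ t)))) ⟩
        3 * t ∎))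

  -- The proportion of faces avoiding an edge

  pascal : ∀ n k → suc n C suc k ≡ n C k + n C suc k
  pascal n k = sym (nCk+nC[k+1]≡[n+1]C[k+1] n k)

  -- The source of the ratio t/n: a given point lies in the proportion (k+1)/(n+1) of the
  -- (k+1)-subsets of n+1 points. The proof splits by Pascal's rule and recombines.
  C-absorption : ∀ n k → suc k * (suc n C suc k) ≡ suc n * (n C k)
  C-absorption zero    zero    = refl
  C-absorption zero    (suc k) = *-zeroʳ (suc (suc k))
  C-absorption (suc n) zero    = begin
    1 * (suc (suc n) C 1)            ≡⟨ cong (1 *_) (pascal (suc n) 0) ⟩
    1 * (1 + (suc n C 1))            ≡⟨ *-distribˡ-+ 1 1 (suc n C 1) ⟩
    1 + 1 * (suc n C 1)              ≡⟨ cong suc (C-absorption n 0) ⟩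
    suc (suc n) * (suc n C 0)        ∎
    where open ≡-Reasoning
  C-absorption (suc n) (suc k) = begin
    suc (suc k) * (suc (suc n) C suc (suc k))
      ≡⟨ cong (suc (suc k) *_) (pascal (suc n) (suc k)) ⟩
    suc (suc k) * (X + (suc n C suc (suc k)))
      ≡⟨ *-distribˡ-+ (suc (suc k)) X _ ⟩
    (X + suc k * X) + suc (suc k) * (suc n C suc (suc k))
      ≡⟨ cong₂ (λ a b → (X + a) + b) (C-absorption n k) (C-absorption n (suc k)) ⟩
    (X + suc n * (n C k)) + suc n * (n C suc k)
      ≡⟨ trans (+-assoc X _ _) (cong (X +_) (trans (sym (*-distribˡ-+ (suc n) (n C k) _))
           (cong (suc n *_) (sym (pascal n k))))) ⟩
    suc (suc n) * X ∎
    where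
    open ≡-Reasoning
    X = suc n C suc k

  C-monoˡ-suc : ∀ n k → n C k ≤ suc n C k
  C-monoˡ-suc n zero    = ≤-refl
  C-monoˡ-suc n (suc k) = ≤-trans (m≤n+m (n C suc k) (n C k)) (≤-reflexive (sym (pascal n k)))

  C-positive : ∀ {n k} → k ≤ n → 0 < n C k
  C-positive {n} {zero}      _         = s≤s z≤n
  C-positive {suc n} {suc k} (s≤s k≤n) =
    ≤-trans (C-positive k≤n) (≤-trans (m≤m+n (n C k) (n C suc k)) (≤-reflexive (sym (pascal n k))))

  -- A union bound over `b` points. Deleting them one at a time, Pascal's rule loses the sets
  -- through the deleted point, at most `n C k` of them by monotonicity.
  C-∸-bound : ∀ n k b → suc n C suc k ≤ (suc n ∸ b) C suc k + b * (n C k)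
  C-∸-bound n       k zero    = m≤m+n _ _
  C-∸-bound zero    k (suc b) = begin
    1 C suc k                                 ≡⟨ pascal 0 k ⟩
    0 C k + 0                                 ≤⟨ +-monoʳ-≤ (0 C k) z≤n ⟩
    suc b * (0 C k)                           ≤⟨ m≤n+m _ ((0 ∸ b) C suc k) ⟩
    (0 ∸ b) C suc k + suc b * (0 C k)         ∎
    where open ≤-Reasoning
  C-∸-bound (suc n) k (suc b) = begin
    suc (suc n) C suc k                                     ≡⟨ pascal (suc n) k ⟩
    X + suc n C suc k                                       ≤⟨ +-monoʳ-≤ X (C-∸-bound n k b) ⟩
    X + ((suc n ∸ b) C suc k + b * (n C k))                 ≤⟨ +-monoʳ-≤ X (+-monoʳ-≤ Y (*-monoʳ-≤ b (C-monoˡ-suc n k))) ⟩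
    X + (Y + b * X)                                         ≡⟨ x∙yz≈y∙xz X Y (b * X) ⟩
    Y + suc b * X                                           ∎
    where
    open ≤-Reasoning
    X = suc n C k
    Y = (suc n ∸ b) C suc k
    x∙yz≈y∙xz : ∀ x y z → x + (y + z) ≡ y + (x + z)
    x∙yz≈y∙xz = solve 3 (λ x y z → x :+ (y :+ z) := y :+ (x :+ z)) refl
      where open +-*-Solver

  -- The factor n + 1 in place of n, at the price of the 2, covers n = 0.
  C-deficit : ∀ n t b → suc n * (n C t) ≤ suc n * ((n ∸ b) C t) + 2 * (b * t) * (n C t)
  C-deficit n       zero    b = m≤m+n _ _
  C-deficit zero    (suc k) b = ≤-trans (≤-reflexive (*-zeroʳ 1)) z≤n
  C-deficit (suc n) (suc k) b = begin
    suc (suc n) * X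
      ≤⟨ *-monoʳ-≤ (suc (suc n)) (C-∸-bound n k b) ⟩
    suc (suc n) * (Y + b * (n C k))
      ≡⟨ *-distribˡ-+ (suc (suc n)) Y _ ⟩
    suc (suc n) * Y + suc (suc n) * (b * (n C k))
      ≤⟨ +-monoʳ-≤ (suc (suc n) * Y) (*-monoˡ-≤ (b * (n C k)) 2+n≤2[1+n]) ⟩
    suc (suc n) * Y + 2 * suc n * (b * (n C k))
      ≡⟨ cong (suc (suc n) * Y +_) (trans (rearrange (suc n) b (n C k))
           (trans (cong (2 * b *_) (sym (C-absorption n k))) (regroup b (suc k) X))) ⟩
    suc (suc n) * Y + 2 * (b * suc k) * X ∎
    where
    open ≤-Reasoning
    X = suc n C suc k
    Y = (suc n ∸ b) C suc k
    2+n≤2[1+n] : suc (suc n) ≤ 2 * suc n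
    2+n≤2[1+n] = s≤s (≤-trans (m≤n+m (suc n) n) (+-monoʳ-≤ n (m≤m+n (suc n) 0)))
    rearrange : ∀ x b c → 2 * x * (b * c) ≡ 2 * b * (x * c)
    rearrange = solve 3 (λ x b c → con 2 :* x :* (b :* c) := con 2 :* b :* (x :* c)) refl
      where open +-*-Solver
    regroup : ∀ b k c → 2 * b * (k * c) ≡ 2 * (b * k) * c
    regroup = solve 3 (λ b k c → con 2 :* b :* (k :* c) := con 2 :* (b :* k) :* c) refl
      where open +-*-Solver

  length-faces : ∀ n t → length (faces n t) ≡ n C t
  length-faces n t = begin
    length (faces n t)
      ≡⟨ ∑-1 (faces n t) ⟨
    ∑[ w ∈ faces n t ] 1
      ≡⟨ ∑-cong (faces n t) (λ w → sym (𝟙-yes (disjoint? ⊥ (value w))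
           (λ (i , i∈) → ∉⊥ (proj₁ (x∈p∩q⁻ ⊥ (value w) i∈))))) ⟩
    ∑[ w ∈ faces n t ] 𝟙 (disjoint? ⊥ (value w))
      ≡⟨ ∑-faces-disjoint n t ⊥ ⟩
    (n ∸ size (⊥ {n})) C t
      ≡⟨ cong (λ b → (n ∸ b) C t) (∣⊥∣≡0 n) ⟩
    n C t ∎
    where open ≡-Reasoning

  length-edges : ∀ n t → length (edges n t) ≡
    ∑[ u ∈ faces n t ] ∑[ v ∈ faces n t ] 𝟙 (disjoint? (value u) (value v))
  length-edges n t = trans (sym (∑-1 (edges n t))) (trans
    (∑-comprehend (λ (u , v) → disjoint? (value u) (value v)) (cartesianProduct ℱ ℱ) (λ _ → 1)
      (λ (u , v) → 𝟙 (disjoint? (value u) (value v)))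
      (λ (u , v) d → sym (𝟙-yes (disjoint? (value u) (value v)) d))
      (λ (u , v) ¬d → 𝟙-no (disjoint? (value u) (value v)) ¬d))
    (∑-× ℱ ℱ (λ (u , v) → 𝟙 (disjoint? (value u) (value v)))))
    where ℱ = faces n t

  length-edges-C : ∀ n t → length (edges n t) ≡ (n C t) * ((n ∸ t) C t)
  length-edges-C n t = begin
    length (edges n t)
      ≡⟨ length-edges n t ⟩
    ∑[ u ∈ faces n t ] ∑[ v ∈ faces n t ] 𝟙 (disjoint? (value u) (value v))
      ≡⟨ ∑-cong (faces n t) (λ u → trans
           (∑-faces-disjoint n t (value u)) (cong (λ b → (n ∸ b) C t) (𝒞-size u))) ⟩
    ∑[ u ∈ faces n t ] ((n ∸ t) C t)
      ≡⟨ ∑-const (faces n t) _ ⟩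
    length (faces n t) * ((n ∸ t) C t)
      ≡⟨ cong (_* ((n ∸ t) C t)) (length-faces n t) ⟩
    (n C t) * ((n ∸ t) C t) ∎
    where open ≡-Reasoning

  #triangles : ℕ → ℕ → ℕ
  #triangles n t = ∑³ (faces n t) (faces n t) (faces n t) (λ u v w →
    𝟙 (disjoint₃? (value u) (value v) (value w)))

  -- With the edge `u`, `v` fixed, the third vertex ranges over the faces that avoid `u ∪ v`.
  #triangles-∪ : ∀ n t → #triangles n t ≡ ∑[ u ∈ faces n t ] ∑[ v ∈ faces n t ]
    𝟙 (disjoint? (value u) (value v)) * ((n ∸ size (value u ∪ value v)) C t)
  #triangles-∪ n t = ∑-cong ℱ (λ u → ∑-cong ℱ (λ v → trans
    (∑-cong ℱ (λ w → trans
      (𝟙-× (disjoint? (value u) (value v)) (disjoint? (value v) (value w) ×-dec disjoint? (value u) (value w)))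
      (cong (𝟙 (disjoint? (value u) (value v)) *_) (both (value u) (value v) (value w)))))
    (trans (∑-*ˡ (𝟙 (disjoint? (value u) (value v))) ℱ _)
      (cong (𝟙 (disjoint? (value u) (value v)) *_) (∑-faces-disjoint n t (value u ∪ value v))))))
    where
    ℱ = faces n t
    both : ∀ u v w → 𝟙 (disjoint? v w ×-dec disjoint? u w) ≡ 𝟙 (disjoint? (u ∪ v) w)
    both u v w = 𝟙-cong (disjoint? v w ×-dec disjoint? u w) (disjoint? (u ∪ v) w)
      (λ (e , d) → Disjoint-∪⁺ u v w d e) (λ d → let e , f = Disjoint-∪⁻ u v w d in f , e)

  -- Compares pairs of an edge and an arbitrary face with those in which the face avoids the edge.
  -- For each edge this is `C-deficit` with b = 2t, whose constant 2(2t)t is `4 * (t * t)`; then sum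
  -- over the edges.
  #triangles-bound : ∀ n t →
    suc n * (length (faces n t) * length (edges n t)) ≤
    suc n * #triangles n t + 4 * (t * t) * (length (faces n t) * length (edges n t))
  #triangles-bound n t rewrite length-faces n t | #triangles-∪ n t | length-edges n t = begin
    suc n * (N * ∑₂ 𝟙ᵈ)
      ≡⟨ *-assoc (suc n) N _ ⟨
    suc n * N * ∑₂ 𝟙ᵈ
      ≡⟨ ∑₂-*ˡ (suc n * N) 𝟙ᵈ ⟨
    ∑₂ (λ u v → suc n * N * 𝟙ᵈ u v)
      ≤⟨ ∑-mono-≤ ℱ (λ u → ∑-mono-≤ ℱ (λ v → pointwise u v)) ⟩
    ∑₂ (λ u v → suc n * (𝟙ᵈ u v * W u v) + 4 * (t * t) * N * 𝟙ᵈ u v)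
      ≡⟨ trans (∑-cong ℱ (λ u → ∑-+ ℱ _ _)) (∑-+ ℱ _ _) ⟩
    ∑₂ (λ u v → suc n * (𝟙ᵈ u v * W u v)) + ∑₂ (λ u v → 4 * (t * t) * N * 𝟙ᵈ u v)
      ≡⟨ cong₂ _+_ (∑₂-*ˡ (suc n) _) (trans (∑₂-*ˡ (4 * (t * t) * N) 𝟙ᵈ) (*-assoc (4 * (t * t)) N _)) ⟩
    suc n * ∑₂ (λ u v → 𝟙ᵈ u v * W u v) + 4 * (t * t) * (N * ∑₂ 𝟙ᵈ) ∎
    where
    open ≤-Reasoning
    ℱ = faces n t
    N = n C t
    ∑₂ : (𝒞 n t → 𝒞 n t → ℕ) → ℕ
    ∑₂ f = ∑[ u ∈ ℱ ] ∑[ v ∈ ℱ ] f u v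
    ∑₂-*ˡ : ∀ c f → ∑₂ (λ u v → c * f u v) ≡ c * ∑₂ f
    ∑₂-*ˡ c f = trans (∑-cong ℱ (λ u → ∑-*ˡ c ℱ (f u))) (∑-*ˡ c ℱ _)
    𝟙ᵈ W : 𝒞 n t → 𝒞 n t → ℕ
    𝟙ᵈ u v = 𝟙 (disjoint? (value u) (value v))
    W u v = (n ∸ size (value u ∪ value v)) C t
    2t : ℕ
    2t = t + t
    pointwise : ∀ u v → suc n * N * 𝟙ᵈ u v ≤ suc n * (𝟙ᵈ u v * W u v) + 4 * (t * t) * N * 𝟙ᵈ u v
    pointwise u v = go (disjoint? (value u) (value v))
      where
      X = (n ∸ 2t) C t
      rearrange : ∀ a x t y → a * x + 2 * ((t + t) * t) * y ≡ a * (1 * x) + 4 * (t * t) * y * 1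
      rearrange = solve 4 (λ a x t y → a :* x :+ con 2 :* ((t :+ t) :* t) :* y
        := a :* (con 1 :* x) :+ con 4 :* (t :* t) :* y :* con 1) refl
        where open +-*-Solver
      go : (d? : Dec (Disjoint (value u) (value v))) →
        suc n * N * 𝟙 d? ≤ suc n * (𝟙 d? * W u v) + 4 * (t * t) * N * 𝟙 d?
      go (no _)  = ≤-trans (≤-reflexive (*-zeroʳ (suc n * N))) z≤n
      go (yes d) rewrite size-∪ (value u) (value v) d | 𝒞-size u | 𝒞-size v = begin
        suc n * N * 1                                     ≡⟨ *-identityʳ _ ⟩
        suc n * N                                         ≤⟨ C-deficit n t 2t ⟩
        suc n * X + 2 * (2t * t) * N                      ≡⟨ rearrange (suc n) X t N ⟩
        suc n * (1 * X) + 4 * (t * t) * N * 1             ∎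

  -- The coboundary of a pivot face

  module _ (π : E n t → S m) where

    private ℱ = faces n t

    consistent? : ∀ {T} (s : Splitting n t T) → Dec ((π (edge-uv s) · π (edge-vw s)) ≈ₚ π (edge-uw s))
    consistent? s = (π (edge-uv s) · π (edge-vw s)) ≈ₚ? π (edge-uw s)

    -- Extended by zero to all triples of faces, so that the three sums range independently and can
    -- be exchanged.
    consistentTriangle : (u v w : 𝒞 n t) → ℕ
    consistentTriangle u v w with disjoint₃? (value u) (value v) (value w)
    ... | yes (d , e , f) = 𝟙 (π ((u , v) , [ d ]) · π ((v , w) , [ e ]) ≈ₚ? π ((u , w) , [ f ]))
    ... | no _            = 0

    consistentTriangle-off : ∀ u v w → ¬ Disjoint₃ (value u) (value v) (value w) → consistentTriangle u v w ≡ 0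
    consistentTriangle-off u v w ¬d₃ with disjoint₃? (value u) (value v) (value w)
    ... | yes d₃ = contradiction d₃ ¬d₃
    ... | no _   = refl

    ∑-consistent : ∑[ T ∈ faces n (3 * t) ] ∑[ s ∈ splittings n t (value T) ] 𝟙 (consistent? s)
      ≡ ∑³ ℱ ℱ ℱ consistentTriangle
    ∑-consistent = trans (∑-triangles n t (λ s → 𝟙 (consistent? s)) consistentTriangle on)
      (∑³-cong ℱ ℱ ℱ (λ u v w →
        𝟙-absorb (disjoint₃? (value u) (value v) (value w)) (consistentTriangle-off u v w)))
      where
      on : ∀ T u v w (p : Splits T (u , v , w)) →
        𝟙 (consistent? {T} ((u , v , w) , [ p ])) ≡ consistentTriangle u v w
      on T u v w (d₃ , _) with disjoint₃? (value u) (value v) (value w)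
      -- Disjointness proofs are irrelevant, so the edges of the splitting and those built from the
      -- decided proofs agree definitionally.
      ... | yes _  = refl
      ... | no ¬d₃ = contradiction d₃ ¬d₃

    -- The identity is an arbitrary default at faces meeting `w`; in a triangle through `w` the
    -- other two faces avoid `w`.
    pivot : 𝒞 n t → 𝒞 n t → S m
    pivot w u with disjoint? (value u) (value w)
    ... | yes d = π ((u , w) , [ d ])
    ... | no _  = Perm.id

    pivot-edge : ∀ u w (d : Disjoint (value u) (value w)) → pivot w u ≡ π ((u , w) , [ d ])
    pivot-edge u w d with disjoint? (value u) (value w)
    ... | yes _ = refl
    ... | no ¬d = contradiction d ¬d

    satisfied? : (g : 𝒞 n t → S m) (e : E n t) → Dec (π e ≈ₚ (g (source e) · g (target e) ⁻¹))
    satisfied? g e = π e ≈ₚ? (g (source e) · g (target e) ⁻¹)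

    -- Each consistent triangle with third vertex `w` makes its edge from `u` to `v` satisfied by
    -- `pivot w`, and for fixed `w` different triangles have different such edges.
    ∑-satisfied-pivot : ∀ w → ∑[ u ∈ ℱ ] ∑[ v ∈ ℱ ] consistentTriangle u v w ≤
      ∑[ e ∈ edges n t ] 𝟙 (satisfied? (pivot w) e)
    ∑-satisfied-pivot w = ≤-trans
      (≤-reflexive (sym (∑-× ℱ ℱ (λ (u , v) → consistentTriangle u v w))))
      (∑-comprehend-≥ (λ (u , v) → disjoint? (value u) (value v)) (cartesianProduct ℱ ℱ) _ _ on
        (λ (u , v) ¬d → consistentTriangle-off u v w (λ (d , _) → ¬d d)))
      where
      on : ∀ ((u , v) : 𝒞 n t × 𝒞 n t) (d : Disjoint (value u) (value v)) →
        consistentTriangle u v w ≤ 𝟙 (satisfied? (pivot w) ((u , v) , [ d ]))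
      on (u , v) d with disjoint₃? (value u) (value v) (value w)
      ... | no _            = z≤n
      ... | yes (_ , e , f) rewrite pivot-edge u w f | pivot-edge v w e =
        𝟙-mono (πuv · πvw ≈ₚ? πuw) (πuv ≈ₚ? πuw · πvw ⁻¹) (λ uv·vw≈uw i →
          -- Right-multiplication by the inverse of `πvw`, done pointwise: the triangle relation is
          -- evaluated at the preimage of `i` under `πvw`.
          trans (cong (πuv ⟨$⟩ʳ_) (sym (inverseʳ πvw))) (uv·vw≈uw (πvw ⟨$⟩ˡ i)))
        where
        πuv = π ((u , v) , [ d ])
        πvw = π ((v , w) , [ e ])
        πuw = π ((u , w) , [ f ])

    ∃-pivot : 0 < length ℱ → ∃[ w ] ∑³ ℱ ℱ ℱ consistentTriangle ≤
      length ℱ * (∑[ e ∈ edges n t ] 𝟙 (satisfied? (pivot w) e))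
    ∃-pivot ℱ≢∅ with ∑-maximum (head ℱ ℱ≢∅) ℱ (λ w → ∑[ u ∈ ℱ ] ∑[ v ∈ ℱ ] consistentTriangle u v w)
      where
      head : (xs : List A) → 0 < length xs → A
      head (x ∷ _) _ = x
    ... | w , ∑≤ = w , (begin
      ∑³ ℱ ℱ ℱ consistentTriangle
        ≡⟨ trans (∑-cong ℱ (λ u → ∑-swap ℱ ℱ _)) (∑-swap ℱ ℱ _) ⟩
      ∑[ w ∈ ℱ ] ∑[ u ∈ ℱ ] ∑[ v ∈ ℱ ] consistentTriangle u v w
        ≤⟨ ∑≤ ⟩
      length ℱ * (∑[ u ∈ ℱ ] ∑[ v ∈ ℱ ] consistentTriangle u v w)
        ≤⟨ *-monoʳ-≤ (length ℱ) (∑-satisfied-pivot w) ⟩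
      length ℱ * (∑[ e ∈ edges n t ] 𝟙 (satisfied? (pivot w) e)) ∎)
      where open ≤-Reasoning

open Counting
open import Data.Rational.Base
open import Data.Rational.Properties
open import Data.Rational.Solver using (module +-*-Solver)

-- Rational probabilities

-- Rationals are kept in lowest terms. Passing to unnormalised fractions turns the arithmetic facts
-- below into integer identities.
fromℕᵘ : ∀ k → toℚᵘ (fromℕ k) ℚᵘ.≃ mkℚᵘ (ℤ.+ k) 0
fromℕᵘ k = toℚᵘ-fromℚᵘ (mkℚᵘ (ℤ.+ k) 0)

recipᵘ : ∀ k → toℚᵘ (recip k) ℚᵘ.≃ mkℚᵘ (ℤ.+ 1) k
recipᵘ k = toℚᵘ-fromℚᵘ (mkℚᵘ (ℤ.+ 1) k)

fromℕ-+ : ∀ a b → fromℕ (a ℕ.+ b) ≡ fromℕ a + fromℕ b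
fromℕ-+ a b = toℚᵘ-injective (begin
  toℚᵘ (fromℕ (a ℕ.+ b))                ≈⟨ fromℕᵘ (a ℕ.+ b) ⟩
  mkℚᵘ (ℤ.+ (a ℕ.+ b)) 0                  ≈⟨ ℚᵘ.*≡* (cong (ℤ._* ℤ.+ 1)
                                             (sym (cong₂ ℤ._+_ (ℤ.*-identityʳ (ℤ.+ a)) (ℤ.*-identityʳ (ℤ.+ b))))) ⟩
  mkℚᵘ (ℤ.+ a) 0 ℚᵘ.+ mkℚᵘ (ℤ.+ b) 0        ≈⟨ ℚᵘ.+-cong (fromℕᵘ a) (fromℕᵘ b) ⟨
  toℚᵘ (fromℕ a) ℚᵘ.+ toℚᵘ (fromℕ b)    ≈⟨ toℚᵘ-homo-+ (fromℕ a) (fromℕ b) ⟨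
  toℚᵘ (fromℕ a + fromℕ b)              ∎)
  where open ℚᵘ.≃-Reasoning

fromℕ-* : ∀ a b → fromℕ (a ℕ.* b) ≡ fromℕ a * fromℕ b
fromℕ-* a b = toℚᵘ-injective (begin
  toℚᵘ (fromℕ (a ℕ.* b))                ≈⟨ fromℕᵘ (a ℕ.* b) ⟩
  mkℚᵘ (ℤ.+ (a ℕ.* b)) 0                  ≈⟨ ℚᵘ.*≡* (cong (ℤ._* ℤ.+ 1) (ℤ.pos-* a b)) ⟩
  mkℚᵘ (ℤ.+ a) 0 ℚᵘ.* mkℚᵘ (ℤ.+ b) 0        ≈⟨ ℚᵘ.*-cong (fromℕᵘ a) (fromℕᵘ b) ⟨
  toℚᵘ (fromℕ a) ℚᵘ.* toℚᵘ (fromℕ b)    ≈⟨ toℚᵘ-homo-* (fromℕ a) (fromℕ b) ⟨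
  toℚᵘ (fromℕ a * fromℕ b)              ∎)
  where open ℚᵘ.≃-Reasoning

fromℕ-mono-≤ : ∀ {a b} → a ℕ.≤ b → fromℕ a ≤ fromℕ b
fromℕ-mono-≤ {a} {b} a≤b = toℚᵘ-cancel-≤ (begin
  toℚᵘ (fromℕ a)   ≃⟨ fromℕᵘ a ⟩
  mkℚᵘ (ℤ.+ a) 0     ≤⟨ ℚᵘ.*≤* (ℤ.*-monoʳ-≤-nonNeg (ℤ.+ 1) (ℤ.+≤+ a≤b)) ⟩
  mkℚᵘ (ℤ.+ b) 0     ≃⟨ fromℕᵘ b ⟨
  toℚᵘ (fromℕ b)   ∎)
  where open ℚᵘ.≤-Reasoning

fromℕ-nonNeg : ∀ k → NonNegative (fromℕ k)
fromℕ-nonNeg k = normalize-nonNeg k 1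

fromℕ-pos : ∀ {k} → 0 ℕ.< k → Positive (fromℕ k)
fromℕ-pos {suc k} _ = normalize-pos (suc k) 1

recip-nonNeg : ∀ k → NonNegative (recip k)
recip-nonNeg k = normalize-nonNeg 1 (suc k)

recip-pos : ∀ k → Positive (recip k)
recip-pos k = normalize-pos 1 (suc k)

recip-antitone : ∀ {j k} → j ℕ.≤ k → recip k ≤ recip j
recip-antitone {j} {k} j≤k = toℚᵘ-cancel-≤ (begin
  toℚᵘ (recip k)   ≃⟨ recipᵘ k ⟩
  mkℚᵘ (ℤ.+ 1) k     ≤⟨ ℚᵘ.*≤* (ℤ.*-monoˡ-≤-nonNeg (ℤ.+ 1) (ℤ.+≤+ (ℕ.s≤s j≤k))) ⟩
  mkℚᵘ (ℤ.+ 1) j     ≃⟨ recipᵘ j ⟨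
  toℚᵘ (recip j)   ∎)
  where open ℚᵘ.≤-Reasoning

recip-inverse : ∀ k → fromℕ (suc k) * recip k ≡ 1ℚ
recip-inverse k = toℚᵘ-injective (begin
  toℚᵘ (fromℕ (suc k) * recip k)               ≈⟨ toℚᵘ-homo-* (fromℕ (suc k)) (recip k) ⟩
  toℚᵘ (fromℕ (suc k)) ℚᵘ.* toℚᵘ (recip k)     ≈⟨ ℚᵘ.*-cong (fromℕᵘ (suc k)) (recipᵘ k) ⟩
  mkℚᵘ (ℤ.+ suc k) 0 ℚᵘ.* mkℚᵘ (ℤ.+ 1) k           ≈⟨ ℚᵘ.*≡* (trans (ℤ.*-identityʳ _) (trans (ℤ.*-identityʳ (ℤ.+ suc k))
                                                    (sym (trans (ℤ.*-identityˡ _) (ℤ.*-identityˡ (ℤ.+ suc k)))))) ⟩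
  toℚᵘ 1ℚ                                      ∎)
  where open ℚᵘ.≃-Reasoning

-- The successor of the index is `suc k * suc a` by computation. Used to cut `recip k` into eight
-- equal parts.
recip-* : ∀ a k → fromℕ (suc a) * recip (a ℕ.+ k ℕ.* suc a) ≡ recip k
recip-* a k = begin
  fromℕ (suc a) * ρ                                     ≡⟨ *-identityʳ _ ⟨
  fromℕ (suc a) * ρ * 1ℚ                                ≡⟨ cong (fromℕ (suc a) * ρ *_) (recip-inverse k) ⟨
  fromℕ (suc a) * ρ * (fromℕ (suc k) * recip k)         ≡⟨ rearrange (fromℕ (suc a)) ρ (fromℕ (suc k)) (recip k) ⟩
  fromℕ (suc k) * fromℕ (suc a) * ρ * recip k           ≡⟨ cong (λ q → q * ρ * recip k) (fromℕ-* (suc k) (suc a)) ⟨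
  fromℕ (suc k ℕ.* suc a) * ρ * recip k                 ≡⟨ cong (_* recip k) (recip-inverse (a ℕ.+ k ℕ.* suc a)) ⟩
  1ℚ * recip k                                          ≡⟨ *-identityˡ (recip k) ⟩
  recip k                                               ∎
  where
  open ≡-Reasoning
  ρ = recip (a ℕ.+ k ℕ.* suc a)
  rearrange : ∀ a r k s → a * r * (k * s) ≡ k * a * r * s
  rearrange = solve 4 (λ a r k s → a :* r :* (k :* s) := k :* a :* r :* s) refl
    where open +-*-Solver

-- Written with `foldr` to agree definitionally with the sum inside `𝔼`.
∑ℚ : List A → (A → ℚ) → ℚ
∑ℚ xs f = foldr _+_ 0ℚ (map f xs)

∑ℚ-*ʳ : ∀ (xs : List A) f c → ∑ℚ xs f * c ≡ ∑ℚ xs (λ x → f x * c)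
∑ℚ-*ʳ []       f c = *-zeroˡ c
∑ℚ-*ʳ (x ∷ xs) f c = trans (*-distribʳ-+ c (f x) _) (cong (f x * c +_) (∑ℚ-*ʳ xs f c))

∑ℚ-fromℕ : ∀ (xs : List A) {f : A → ℚ} {g : A → ℕ} → (∀ x → f x ≡ fromℕ (g x)) → ∑ℚ xs f ≡ fromℕ (∑ xs g)
∑ℚ-fromℕ []       f≗g = refl
∑ℚ-fromℕ (x ∷ xs) {g = g} f≗g = trans (cong₂ _+_ (f≗g x) (∑ℚ-fromℕ xs f≗g)) (sym (fromℕ-+ (g x) (∑ xs g)))

-- Multiplying by the length rather than dividing by it covers the empty list, where both sides are
-- 0.
𝔼-*-length : ∀ (xs : List A) f → 𝔼 xs f * fromℕ (length xs) ≡ ∑ℚ xs f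
𝔼-*-length []          f = refl
𝔼-*-length xs@(_ ∷ ys) f = begin
  ∑ℚ xs f * recip k * fromℕ (suc k)       ≡⟨ *-assoc (∑ℚ xs f) _ _ ⟩
  ∑ℚ xs f * (recip k * fromℕ (suc k))     ≡⟨ cong (∑ℚ xs f *_) (trans (*-comm (recip k) _) (recip-inverse k)) ⟩
  ∑ℚ xs f * 1ℚ                            ≡⟨ *-identityʳ _ ⟩
  ∑ℚ xs f                                 ∎
  where
  open ≡-Reasoning
  k = length ys

IsProbability : ℚ → Set
IsProbability p = 0ℚ ≤ p × p ≤ 1ℚ

∑ℚ-probability : ∀ (xs : List A) {f} → (∀ x → IsProbability (f x)) → 0ℚ ≤ ∑ℚ xs f × ∑ℚ xs f ≤ fromℕ (length xs)
∑ℚ-probability []       p = ≤-refl , ≤-refl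
∑ℚ-probability (x ∷ xs) {f} p with p x | ∑ℚ-probability xs p
... | 0≤ , ≤1 | 0≤∑ , ∑≤ =
  +-mono-≤ 0≤ 0≤∑ , subst (∑ℚ (x ∷ xs) f ≤_) (sym (fromℕ-+ 1 (length xs))) (+-mono-≤ ≤1 ∑≤)

scale-probability : ∀ {s l r} → NonNegative r → l * r ≡ 1ℚ → 0ℚ ≤ s × s ≤ l → IsProbability (s * r)
scale-probability {s} {l} {r} r≥0 lr≡1 (0≤s , s≤l) =
  subst (_≤ s * r) (*-zeroˡ r) (*-monoʳ-≤-nonNeg r {{r≥0}} 0≤s) ,
  subst (s * r ≤_) lr≡1 (*-monoʳ-≤-nonNeg r {{r≥0}} s≤l)

𝔼-probability : ∀ (xs : List A) {f} → (∀ x → IsProbability (f x)) → IsProbability (𝔼 xs f)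
𝔼-probability []          p = ≤-refl , nonNegative⁻¹ 1ℚ
𝔼-probability xs@(_ ∷ ys) p =
  scale-probability (recip-nonNeg (length ys)) (recip-inverse (length ys)) (∑ℚ-probability xs p)

Pr-probability : ∀ {P : A → Set} (xs : List A) (P? : Decidable P) → IsProbability (Pr xs P?)
Pr-probability xs P? = 𝔼-probability xs (λ x → indicator (does (P? x)))
  where
  indicator : ∀ b → IsProbability (if b then 1ℚ else 0ℚ)
  indicator true  = nonNegative⁻¹ 1ℚ , ≤-refl
  indicator false = ≤-refl , nonNegative⁻¹ 1ℚ

Pr-*-length : ∀ {P : A → Set} (xs : List A) (P? : Decidable P) →
  Pr xs P? * fromℕ (length xs) ≡ fromℕ (∑[ x ∈ xs ] 𝟙 (P? x))
Pr-*-length xs P? = trans (𝔼-*-length xs _) (∑ℚ-fromℕ xs (λ x → indicator (does (P? x))))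
  where
  indicator : ∀ b → (if b then 1ℚ else 0ℚ) ≡ fromℕ (if b then 1 else 0)
  indicator true  = refl
  indicator false = refl

-- Here `s` is n+1, `r` its inverse, `a` the number of triangles, `x` the number of pairs of a face
-- and an edge, `c` is 4t², and `p`, `p′` are the triangle and coboundary probabilities. Multiply
-- the deficit by `p`, bound `p` by 1 in the error term only, and cancel `s * x`.
average-deficit : ∀ {p p′ s a c r x y} → IsProbability p → Positive s → Positive x → NonNegative c →
  s * r ≡ 1ℚ → s * x ≤ s * a + c * x → p * a ≤ y → y ≡ p′ * x → p ≤ p′ + c * r
average-deficit {p} {p′} {s} {a} {c} {r} {x} {y} (0≤p , p≤1) s>0 x>0 c≥0 sr≡1 deficit pa≤y y≡p′x =
  *-cancelʳ-≤-pos (s * x) {{pos*pos⇒pos s {{s>0}} x {{x>0}}}} (begin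
    p * (s * x)                       ≤⟨ *-monoˡ-≤-nonNeg p {{nonNegative 0≤p}} deficit ⟩
    p * (s * a + c * x)               ≡⟨ expand p s a (c * x) ⟩
    s * (p * a) + p * (c * x)         ≤⟨ +-mono-≤ (*-monoˡ-≤-nonNeg s {{pos⇒nonNeg s {{s>0}}}} pa≤y)
                                           (*-monoʳ-≤-nonNeg (c * x) {{cx≥0}} p≤1) ⟩
    s * y + 1ℚ * (c * x)              ≡⟨ cong₂ (λ u v → s * u + v * (c * x)) y≡p′x (sym sr≡1) ⟩
    s * (p′ * x) + s * r * (c * x)    ≡⟨ collect p′ s x r c ⟩
    (p′ + c * r) * (s * x)            ∎)
  where
  open ≤-Reasoning
  cx≥0 : NonNegative (c * x)
  cx≥0 = nonNeg*nonNeg⇒nonNeg c {{c≥0}} x {{pos⇒nonNeg x {{x>0}}}}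
  expand : ∀ p s a x → p * (s * a + x) ≡ s * (p * a) + p * x
  expand = solve 4 (λ p s a x → p :* (s :* a :+ x) := s :* (p :* a) :+ p :* x) refl
    where open +-*-Solver
  collect : ∀ p s x r c → s * (p * x) + s * r * (c * x) ≡ (p + c * r) * (s * x)
  collect = solve 5 (λ p s x r c →
    s :* (p :* x) :+ s :* r :* (c :* x) := (p :+ c :* r) :* (s :* x)) refl
    where open +-*-Solver

-- From triangle consistency to coboundary probability

module _ {n t m : ℕ} (π : E n t → S m) where

  private
    ℱ = faces n t
    𝒯 = faces n (3 ℕ.* t)

  -- Each `3 * t`-set has the same number `K` of splittings, so the average of averages has the
  -- single denominator `length 𝒯 ℕ.* K`, which is the number of triangles.
  Pr-triangle-* : Pr-triangle π * fromℕ (#triangles n t) ≡ fromℕ (∑³ ℱ ℱ ℱ (consistentTriangle π))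
  Pr-triangle-* = begin
    Pr-triangle π * fromℕ (#triangles n t)
      ≡⟨ cong (λ a → Pr-triangle π * fromℕ a) #triangles≡ ⟩
    Pr-triangle π * fromℕ (length 𝒯 ℕ.* K)
      ≡⟨ trans (cong (Pr-triangle π *_) (fromℕ-* (length 𝒯) K)) (sym (*-assoc (Pr-triangle π) _ _)) ⟩
    Pr-triangle π * fromℕ (length 𝒯) * fromℕ K
      ≡⟨ cong (_* fromℕ K) (𝔼-*-length 𝒯 _) ⟩
    ∑ℚ 𝒯 (λ T → Pr (splittings n t (value T)) (consistent? π)) * fromℕ K
      ≡⟨ ∑ℚ-*ʳ 𝒯 _ (fromℕ K) ⟩
    ∑ℚ 𝒯 (λ T → Pr (splittings n t (value T)) (consistent? π) * fromℕ K)
      ≡⟨ ∑ℚ-fromℕ 𝒯 (λ T → trans (cong (λ k → Pr (splittings n t (value T)) (consistent? π) * fromℕ k)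
             (sym (length-splittings n t (value T) (𝒞-size T))))
           (Pr-*-length (splittings n t (value T)) (consistent? π))) ⟩
    fromℕ (∑[ T ∈ 𝒯 ] ∑[ s ∈ splittings n t (value T) ] 𝟙 (consistent? π s))
      ≡⟨ cong fromℕ (∑-consistent π) ⟩
    fromℕ (∑³ ℱ ℱ ℱ (consistentTriangle π)) ∎
    where
    open ≡-Reasoning
    K = splittingCount t
    #triangles≡ : #triangles n t ≡ length 𝒯 ℕ.* K
    #triangles≡ = begin
      #triangles n t
        ≡⟨ ∑³-cong ℱ ℱ ℱ (λ u v w → sym (ℕ.*-identityʳ _)) ⟩
      ∑³ ℱ ℱ ℱ (λ u v w → 𝟙 (disjoint₃? (value u) (value v) (value w)) ℕ.* 1)
        ≡⟨ ∑-triangles n t (λ _ → 1) (λ _ _ _ → 1) (λ _ _ _ _ _ → refl) ⟨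
      ∑[ T ∈ 𝒯 ] ∑[ s ∈ splittings n t (value T) ] 1
        ≡⟨ ∑-cong 𝒯 (λ T → trans
             (∑-1 (splittings n t (value T))) (length-splittings n t (value T) (𝒞-size T))) ⟩
      ∑[ T ∈ 𝒯 ] K
        ≡⟨ ∑-const 𝒯 K ⟩
      length 𝒯 ℕ.* K ∎

  Pr-triangle-probability : IsProbability (Pr-triangle π)
  Pr-triangle-probability = 𝔼-probability 𝒯 (λ T → Pr-probability (splittings n t (value T)) (consistent? π))

  -- Since 2t ≤ 3t ≤ n, faces and edges exist, so `N ℕ.* M` is positive and `average-deficit` can
  -- cancel it. The witness `g` is the pivot function of the face from `∃-pivot`.
  Pr-triangle≤Pr-coboundary : 3 ℕ.* t ℕ.≤ n →
    ∃[ g ] Pr-triangle π ≤ Pr-coboundary π g + fromℕ (4 ℕ.* (t ℕ.* t)) * recip n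
  Pr-triangle≤Pr-coboundary 3t≤n = g ,
    average-deficit {p′ = Pr-coboundary π g} {s = fromℕ (suc n)} {a = fromℕ (#triangles n t)}
      {c = fromℕ c} {x = fromℕ (N ℕ.* M)}
    Pr-triangle-probability
    (fromℕ-pos {suc n} (ℕ.s≤s ℕ.z≤n)) (fromℕ-pos {N ℕ.* M} (ℕ.*-mono-< N>0 M>0)) (fromℕ-nonNeg c)
    (recip-inverse n) deficit
    (≤-trans (≤-reflexive Pr-triangle-*)
      (fromℕ-mono-≤ {∑³ ℱ ℱ ℱ (consistentTriangle π)} {N ℕ.* Sat} (proj₂ (∃-pivot π N>0))))
    majority
    where
    N = length ℱ
    M = length (edges n t)
    c = 4 ℕ.* (t ℕ.* t)
    t≤n∸t : t ℕ.≤ n ℕ.∸ t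
    t≤n∸t = ℕ.m+n≤o⇒m≤o∸n t (ℕ.≤-trans (ℕ.+-monoʳ-≤ t (ℕ.m≤m+n t (t ℕ.+ 0))) 3t≤n)
    t≤n : t ℕ.≤ n
    t≤n = ℕ.≤-trans t≤n∸t (ℕ.m∸n≤m n t)
    N>0 : 0 ℕ.< N
    N>0 = subst (0 ℕ.<_) (sym (length-faces n t)) (C-positive t≤n)
    M>0 : 0 ℕ.< M
    M>0 = subst (0 ℕ.<_) (sym (length-edges-C n t)) (ℕ.*-mono-< (C-positive t≤n) (C-positive t≤n∸t))
    g : 𝒞 n t → S m
    g = pivot π (proj₁ (∃-pivot π N>0))
    Sat = ∑[ e ∈ edges n t ] 𝟙 (satisfied? π g e)
    majority : fromℕ (N ℕ.* Sat) ≡ Pr-coboundary π g * fromℕ (N ℕ.* M)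
    majority = begin
      fromℕ (N ℕ.* Sat)                          ≡⟨ fromℕ-* N Sat ⟩
      fromℕ N * fromℕ Sat                        ≡⟨ cong (fromℕ N *_) (Pr-*-length (edges n t) (satisfied? π g)) ⟨
      fromℕ N * (Pr-coboundary π g * fromℕ M)    ≡⟨ x∙yz≡y∙xz (fromℕ N) (Pr-coboundary π g) (fromℕ M) ⟩
      Pr-coboundary π g * (fromℕ N * fromℕ M)    ≡⟨ cong (Pr-coboundary π g *_) (fromℕ-* N M) ⟨
      Pr-coboundary π g * fromℕ (N ℕ.* M)        ∎
      where
      open ≡-Reasoning
      x∙yz≡y∙xz : ∀ x y z → x * (y * z) ≡ y * (x * z)
      x∙yz≡y∙xz = solve 3 (λ x y z → x :* (y :* z) := y :* (x :* z)) refl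
        where open +-*-Solver
    deficit : fromℕ (suc n) * fromℕ (N ℕ.* M) ≤
      fromℕ (suc n) * fromℕ (#triangles n t) + fromℕ c * fromℕ (N ℕ.* M)
    deficit = begin
      fromℕ (suc n) * fromℕ (N ℕ.* M)
        ≡⟨ fromℕ-* (suc n) (N ℕ.* M) ⟨
      fromℕ (suc n ℕ.* (N ℕ.* M))
        ≤⟨ fromℕ-mono-≤ {suc n ℕ.* (N ℕ.* M)} {suc n ℕ.* #triangles n t ℕ.+ c ℕ.* (N ℕ.* M)}
             (#triangles-bound n t) ⟩
      fromℕ (suc n ℕ.* #triangles n t ℕ.+ c ℕ.* (N ℕ.* M))
        ≡⟨ fromℕ-+ (suc n ℕ.* #triangles n t) (c ℕ.* (N ℕ.* M)) ⟩
      fromℕ (suc n ℕ.* #triangles n t) + fromℕ (c ℕ.* (N ℕ.* M))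
        ≡⟨ cong₂ _+_ (fromℕ-* (suc n) (#triangles n t)) (fromℕ-* c (N ℕ.* M)) ⟩
      fromℕ (suc n) * fromℕ (#triangles n t) + fromℕ c * fromℕ (N ℕ.* M) ∎
      where open ≤-Reasoning

p≤∣p∣ : ∀ p → p ≤ ∣ p ∣
p≤∣p∣ p with ≤-total 0ℚ p
... | inj₁ 0≤p = ≤-reflexive (sym (0≤p⇒∣p∣≡p 0≤p))
... | inj₂ p≤0 = ≤-trans p≤0 (0≤∣p∣ p)

-- The error term

error : (ℕ → ℕ) → ℕ → ℚ
error r n = fromℕ (4 ℕ.* (r n ℕ.* r n)) * recip n

error-nonNeg : ∀ r n → NonNegative (error r n)
error-nonNeg r n = nonNeg*nonNeg⇒nonNeg (fromℕ (4 ℕ.* (r n ℕ.* r n))) {{fromℕ-nonNeg (4 ℕ.* (r n ℕ.* r n))}}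
  (recip n) {{recip-nonNeg n}}

recip-1+2k-≤ : ∀ k → recip (1 ℕ.+ 2 ℕ.* k) ≤ recip k
recip-1+2k-≤ k = recip-antitone {k} {1 ℕ.+ 2 ℕ.* k} (ℕ.≤-trans (ℕ.m≤m+n k _) (ℕ.n≤1+n _))

-- Each real addition sends the index k to 2k+1, so the goal at `k` reads `ξ` at the same place as
-- the hypothesis at `k′`. The error allowed at `k′` is smaller than that at `k`.
≤ᴿ-weaken : ∀ ξ {e p p′} → p ≤ p′ + e →
  1ᴿ -ᴿ ξ ≤ᴿ fromℚ p → 1ᴿ -ᴿ (ξ +ᴿ fromℚ e) ≤ᴿ fromℚ p′
≤ᴿ-weaken ξ {e} {p} {p′} p≤p′+e 1-ξ≤p k = begin
  1ℚ + - (x + e) - p′       ≡⟨ regroup x e p′ ⟩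
  1ℚ + - x - (p′ + e)       ≤⟨ +-monoʳ-≤ (1ℚ + - x) (neg-antimono-≤ p≤p′+e) ⟩
  1ℚ + - x - p              ≤⟨ 1-ξ≤p k′ ⟩
  recip k′ + recip k′       ≤⟨ +-mono-≤ (recip-1+2k-≤ k) (recip-1+2k-≤ k) ⟩
  recip k + recip k         ∎
  where
  open ≤-Reasoning
  k′ = 1 ℕ.+ 2 ℕ.* k
  x = seq ξ (1 ℕ.+ 2 ℕ.* k′)
  regroup : ∀ x e p → 1ℚ + - (x + e) - p ≡ 1ℚ + - x - (p + e)
  regroup = solve 3 (λ x e p → con 1ℚ :+ :- (x :+ e) :- p := con 1ℚ :+ :- x :- (p :+ e)) refl
    where open +-*-Solver

error-mono-≤ : ∀ {t} r n → t ℕ.≤ r n → fromℕ (4 ℕ.* (t ℕ.* t)) * recip n ≤ error r n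
error-mono-≤ {t} r n t≤r = *-monoʳ-≤-nonNeg (recip n) {{recip-nonNeg n}}
  (fromℕ-mono-≤ {4 ℕ.* (t ℕ.* t)} {4 ℕ.* (r n ℕ.* r n)} (ℕ.*-monoʳ-≤ 4 (ℕ.*-mono-≤ t≤r t≤r)))

expander : ∀ r n m ξ → IsUGCoboundaryExpander n m (r n) ξ (ξ +ᴿ fromℚ (error r n))
expander r n m ξ t t≤r 3t≤n π _ consistent = g , ≤ᴿ-weaken ξ
  (≤-trans P≤P′+e (+-monoʳ-≤ (Pr-coboundary π g) (error-mono-≤ r n t≤r))) consistent
  where
  g = proj₁ (Pr-triangle≤Pr-coboundary π 3t≤n)
  P≤P′+e = proj₂ (Pr-triangle≤Pr-coboundary π 3t≤n)

-- Applied with `x` = r(n)², `y` = n, `z` = 1/(n+1). The little-o bound produces ρ², weakened to ρ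
-- by ρ ≤ 1 so that the error is linear in ρ.
square-scale : ∀ {c ρ x y z} → NonNegative c → NonNegative ρ → NonNegative z → ρ ≤ 1ℚ →
  x ≤ ρ * ρ * y → y * z ≤ 1ℚ → c * x * z ≤ c * ρ
square-scale {c} {ρ} {x} {y} {z} c≥0 ρ≥0 z≥0 ρ≤1 x≤ρ²y yz≤1 = begin
  c * x * z              ≡⟨ *-assoc c x z ⟩
  c * (x * z)            ≤⟨ *-monoˡ-≤-nonNeg c {{c≥0}} (begin
    x * z                  ≤⟨ *-monoʳ-≤-nonNeg z {{z≥0}} x≤ρ²y ⟩
    ρ * ρ * y * z          ≡⟨ *-assoc (ρ * ρ) y z ⟩
    ρ * ρ * (y * z)        ≤⟨ *-monoˡ-≤-nonNeg (ρ * ρ) {{nonNeg*nonNeg⇒nonNeg ρ {{ρ≥0}} ρ {{ρ≥0}}}} yz≤1 ⟩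
    ρ * ρ * 1ℚ             ≡⟨ *-identityʳ (ρ * ρ) ⟩
    ρ * ρ                  ≤⟨ *-monoˡ-≤-nonNeg ρ {{ρ≥0}} ρ≤1 ⟩
    ρ * 1ℚ                 ≡⟨ *-identityʳ ρ ⟩
    ρ                      ∎) ⟩
  c * ρ                  ∎
  where open ≤-Reasoning

error-small : ∀ r → IsLittleO√ r → ∀ j → ∃[ N ] (∀ n → n ℕ.≥ N → error r n ≤ fromℕ 4 * recip j)
error-small r r=o√ j = proj₁ eventually , λ n n≥N →
  subst (λ q → q * recip n ≤ fromℕ 4 * recip j) (sym (fromℕ-* 4 (r n ℕ.* r n)))
    (square-scale {y = fromℕ n} (fromℕ-nonNeg 4) (recip-nonNeg j) (recip-nonNeg n) (recip-antitone {0} {j} ℕ.z≤n)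
      (proj₂ eventually n n≥N) (n*recip-n≤1 n))
  where
  -- The constant of the little-o hypothesis is ρ = 1/(j+1).
  eventually = r=o√ (recip j) (positive⁻¹ (recip j) {{recip-pos j}})
  n*recip-n≤1 : ∀ n → fromℕ n * recip n ≤ 1ℚ
  n*recip-n≤1 n = subst (fromℕ n * recip n ≤_) (recip-inverse n)
    (*-monoʳ-≤-nonNeg (recip n) {{recip-nonNeg n}} (fromℕ-mono-≤ {n} {suc n} (ℕ.n≤1+n n)))

-- With ρ = 1/(j+1) one eighth of κ = 1/(k+1), of the excess κ = 8ρ of d = δₖ the
-- passage to d′ = δⱼ costs ρ and e costs at most 4ρ, leaving 3ρ.
margin : ∀ {κ ρ d d′ e} → NonNegative ρ → fromℕ 8 * ρ ≡ κ →
  κ + κ < d - 0ℚ → d - d′ ≤ κ + ρ → e ≤ fromℕ 4 * ρ → ρ + ρ < d′ - e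
margin {κ} {ρ} {d} {d′} {e} ρ≥0 8ρ≡κ 2κ<d drift e≤4ρ = begin-strict
  ρ + ρ                                      ≡⟨ +-identityʳ (ρ + ρ) ⟨
  ρ + ρ + 0ℚ                                 ≤⟨ +-monoʳ-≤ (ρ + ρ) (nonNegative⁻¹ ρ {{ρ≥0}}) ⟩
  ρ + ρ + ρ                                  ≡⟨ budget κ ρ ⟩
  κ + fromℕ 8 * ρ - (κ + ρ) - fromℕ 4 * ρ    ≡⟨ cong (λ q → κ + q - (κ + ρ) - fromℕ 4 * ρ) 8ρ≡κ ⟩
  κ + κ - (κ + ρ) - fromℕ 4 * ρ              <⟨ +-monoˡ-< (- (fromℕ 4 * ρ)) (+-monoˡ-< (- (κ + ρ)) 2κ<d) ⟩
  d - 0ℚ - (κ + ρ) - fromℕ 4 * ρ             ≤⟨ +-mono-≤ (+-monoʳ-≤ (d - 0ℚ) (neg-antimono-≤ drift))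
                                                           (neg-antimono-≤ e≤4ρ) ⟩
  d - 0ℚ - (d - d′) - e                      ≡⟨ cancel d d′ e ⟩
  d′ - e                                     ∎
  where
  open ≤-Reasoning
  budget : ∀ x y → y + y + y ≡ x + fromℕ 8 * y - (x + y) - fromℕ 4 * y
  budget = solve 2 (λ x y → y :+ y :+ y :=
    x :+ con (fromℕ 8) :* y :- (x :+ y) :- con (fromℕ 4) :* y) refl
    where open +-*-Solver
  cancel : ∀ d d′ e → d - 0ℚ - (d - d′) - e ≡ d′ - e
  cancel = solve 3 (λ d d′ e → d :- con 0ℚ :- (d :- d′) :- e := d′ :- e) refl
    where open +-*-Solver

-- Nonnegativity of the error gives the lower bound at the index `k` witnessing that δ is positive.
-- The upper bound needs a finer index `j`, so that the change of approximation and the error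
-- together fit into the excess.
error-tendsToZero : ∀ r → IsLittleO√ r → TendsToZero (fromℚ ∘ error r)
error-tendsToZero r r=o√ δ (k , 2/k<δₖ) = proj₁ eventually , λ n n≥N →
  (k , lower n) ,
  (j , margin {d = seq δ k} {seq δ j} (recip-nonNeg j) (recip-* 7 k) 2/k<δₖ drift (proj₂ eventually n n≥N))
  where
  -- Chosen so that j+1 = 8(k+1), as `recip-*` with `a` = 7 requires.
  j = 7 ℕ.+ k ℕ.* 8
  eventually = error-small r r=o√ j
  drift : seq δ k - seq δ j ≤ recip k + recip j
  drift = ≤-trans (p≤∣p∣ (seq δ k - seq δ j)) (regular δ k j)
  lower : ∀ n → recip k + recip k < error r n - - seq δ k
  lower n = <-≤-trans (subst (recip k + recip k <_) (rearrange (seq δ k)) 2/k<δₖ)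
    (+-monoˡ-≤ (- - seq δ k) (nonNegative⁻¹ (error r n) {{error-nonNeg r n}}))
    where
    rearrange : ∀ d → d - 0ℚ ≡ 0ℚ - - d
    rearrange = solve 1 (λ d → d :- con 0ℚ := con 0ℚ :- :- d) refl
      where open +-*-Solver

lemma6p3 : (r : ℕ → ℕ) → IsLittleO√ r →
    ∃[ ε ] (∀ n → 0ᴿ ≤ᴿ ε n) × TendsToZero ε
    × (∀ (n m : ℕ) (ξ : ℝ) → 0ᴿ <ᴿ ξ → ξ <ᴿ 1ᴿ →
    IsUGCoboundaryExpander n m (r n) ξ (ξ +ᴿ ε n))
lemma6p3 r r=o√ = fromℚ ∘ error r , nonneg , error-tendsToZero r r=o√ , λ n m ξ _ _ → expander r n m ξ
  where
  nonneg : ∀ n → 0ᴿ ≤ᴿ fromℚ (error r n)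
  nonneg n k = begin
    0ℚ - error r n        ≤⟨ +-monoʳ-≤ 0ℚ (neg-antimono-≤ (nonNegative⁻¹ (error r n) {{error-nonNeg r n}})) ⟩
    0ℚ                    ≤⟨ +-mono-≤ 0≤recip 0≤recip ⟩
    recip k + recip k     ∎
    where
    open ≤-Reasoning
    0≤recip = nonNegative⁻¹ (recip k) {{recip-nonNeg k}}
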